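{- A permutation class $\mathcal{C}\subseteq\operatorname{Av}(321)$ is well-quasi-ordered (under permutation containment) if and only if $\mathcal{C}\cap U$ is finite.
   Context: A permutation class is a set of permutations closed downward under containment; it is well-quasi-ordered if it contains no infinite antichain. For a permutation $\pi$, the inversion graph $G_\pi$ has vertex set $\{(i,\pi(i))\}$, with $(i,\pi(i))$ and $(j,\pi(j))$ adjacent if $i<j$ and $\pi(i)>\pi(j)$. A double-ended fork is the graph formed from a path by adding four new vertices of degree one, two adjacent to one end of the path and two adjacent to the other end. $U$ is the set of all permutations whose inversion graph is isomorphic to a double-ended fork. -}

module Defs where

open import Level using (0ℓ)
open import Data.Nat using (ℕ; zero; suc; pred; _+_; _<_; _≤_)
open import Data.Fin using (Fin; toℕ) renaming (_<_ to _<ᶠ_)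
open import Data.List using (List; []; _∷_; length; lookup)
open import Data.List.Relation.Unary.All using (All)
open import Data.List.Relation.Unary.Unique.Propositional using (Unique)
open import Data.List.Membership.Propositional using (_∈_)
open import Data.Product using (Σ; _×_; ∃)
open import Data.Sum using (_⊎_)
open import Relation.Nullary using (¬_)
open import Relation.Binary.PropositionalEquality using (_≡_; _≢_)
open import Function.Bundles using (_⇔_)
open import Function.Definitions using (Bijective)

-- Permutations of length n are one-line notations: lists of the values
-- 0,…,n-1 each occurring exactly once.
IsPerm : List ℕ → Set
IsPerm xs = All (_< length xs) xs × Unique xs

_≼_ : List ℕ → List ℕ → Set
σ ≼ π = Σ (Fin (length σ) → Fin (length π)) λ f →
          (∀ i j → i <ᶠ j → f i <ᶠ f j) ×
          (∀ i j → (lookup σ i < lookup σ j) ⇔ (lookup π (f i) < lookup π (f j)))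

IsPermClass : (List ℕ → Set) → Set
IsPermClass C = (∀ π → C π → IsPerm π) ×
                (∀ σ π → IsPerm σ → σ ≼ π → C π → C σ)

p321 : List ℕ
p321 = 2 ∷ 1 ∷ 0 ∷ []

SubsetAv321 : (List ℕ → Set) → Set
SubsetAv321 C = ∀ π → C π → ¬ (p321 ≼ π)

InfiniteAntichain : (List ℕ → Set) → Set
InfiniteAntichain C = Σ (ℕ → List ℕ) λ a →
  (∀ i → C (a i)) × (∀ i j → i ≢ j → ¬ (a i ≼ a j))

WQO : (List ℕ → Set) → Set
WQO C = ¬ InfiniteAntichain C

Graph : ℕ → Set₁
Graph n = Fin n → Fin n → Set

_≅G_ : ∀ {n m} → Graph n → Graph m → Set
_≅G_ {n} {m} G H = Σ (Fin n → Fin m) λ f →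
  Bijective _≡_ _≡_ f × (∀ u v → G u v ⇔ H (f u) (f v))

InvGraph : (π : List ℕ) → Graph (length π)
InvGraph π i j = (i <ᶠ j × lookup π j < lookup π i) ⊎ (j <ᶠ i × lookup π i < lookup π j)

-- Double-ended fork built on a path with k vertices 0,…,k-1; extra leaves
-- k, k+1 attached to vertex 0 and k+2, k+3 attached to vertex k-1.
data ForkEdge (k : ℕ) : ℕ → ℕ → Set where
  path   : ∀ {u} → suc u < k → ForkEdge k u (suc u)
  leftA  : ForkEdge k 0 k
  leftB  : ForkEdge k 0 (suc k)
  rightA : ForkEdge k (pred k) (suc (suc k))
  rightB : ForkEdge k (pred k) (suc (suc (suc k)))

Fork : (k : ℕ) → Graph (k + 4)
Fork k u v = ForkEdge k (toℕ u) (toℕ v) ⊎ ForkEdge k (toℕ v) (toℕ u)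

InU : List ℕ → Set
InU π = IsPerm π × ∃ λ k → 2 ≤ k × (InvGraph π ≅G Fork k)

Finite : (List ℕ → Set) → Set
Finite P = ∃ λ (L : List (List ℕ)) → ∀ π → P π → π ∈ L

_∩_ : (List ℕ → Set) → (List ℕ → Set) → (List ℕ → Set)
(P ∩ Q) x = P x × Q x

{-# OPTIONS --safe #-}

-- In one direction, double-ended forks of different sizes do not embed in each other: the two
-- vertices of degree at least three must be matched, and they are at different distances.
--
-- In the other direction, every 321-avoiding permutation is a direct sum of indecomposable ones,
-- so by Higman's lemma it suffices to treat these. The points of an indecomposable one split into
-- left-to-right maxima and the others, and a greedy geodesic p 0, p 1, … in its inversion graph cuts
-- each of these two increasing sequences into cells, where cell i ends with p i and only interacts
-- with its two neighbouring cells. A second point in cell i, together with the path, forms one end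
-- of a fork, so two cells far apart with more than one point yield a long fork. As those are
-- excluded, all cells are singletons except in a window of bounded length a, …, a + N. Merging the
-- points of the window into one list, consistently with the relative order of neighbouring cells,
-- turns the window into a word over a finite alphabet, and the permutation is encoded by this word and
-- the numbers of cells before and after a; Higman's lemma applies again.
module Submission where

open import Defs
open import Level using (0ℓ)
open import Data.Bool using (Bool; true; false; not)
import Data.Bool.Properties as Bool
open import Data.Empty using (⊥; ⊥-elim)
open import Data.Fin as Fin using (Fin; toℕ; fromℕ<; punchOut) renaming (_<_ to _<ᶠ_)
import Data.Fin.Properties as Fin
open import Data.List using (List; []; _∷_; _++_; length; lookup; map; take; drop; allFin; filter;
  tabulate; upTo; cartesianProductWith)
open import Data.List.Membership.Propositional using (_∈_)
open import Data.List.Membership.Propositional.Properties using (∈-allFin; ∈-lookup;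
  ∈-cartesianProductWith⁺; ∈-upTo⁺)
open import Data.List.Properties using (take++drop≡id; ++-assoc; ++-identityʳ; length-++;
  length-tabulate; lookup-tabulate; filter-notAll)
open import Data.List.Relation.Unary.All as All using (All; []; _∷_)
import Data.List.Relation.Unary.All.Properties as All
open import Data.List.Relation.Unary.AllPairs using (AllPairs; []; _∷_)
open import Data.List.Relation.Unary.Any using (Any; here; there; index)
open import Data.List.Relation.Unary.Any.Properties using (lookup-index)
open import Data.List.Relation.Unary.Unique.Propositional using (Unique)
import Data.List.Relation.Unary.Unique.Propositional.Properties as Unique
open import Data.Nat
open import Data.Nat.Induction using (<-rec)
open import Data.Nat.ListAction using (sum)
open import Data.Nat.Properties
open import Data.Product using (Σ; ∃; ∃₂; _×_; _,_; proj₁; proj₂; swap)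
open import Data.Sum as Sum using (_⊎_; inj₁; inj₂)
open import Data.Unit using (⊤; tt)
open import Function using (_∘_; id)
open import Function.Bundles using (_⇔_; mk⇔; Equivalence)
open import Function.Definitions using (Bijective)
open import Relation.Binary.Definitions using (tri<; tri≈; tri>)
open import Relation.Binary.PropositionalEquality
open import Relation.Nullary
open import Relation.Unary using (Decidable)
open import Axiom.ExcludedMiddle using (ExcludedMiddle)

-- Well-quasi-orders

-- A point has two keys, position and value, and an embedding must respect both. Words suffice
-- because points two or more cells apart are ordered alike in both keys, and consecutive cells are
-- separated in the key of the higher cell, so that only the key of the lower cell interleaves them.
-- One bit per close pair remains, and the order of a single list carries all these bits; a letter
-- only has to give the cell number relative to `a`. If the lower of two consecutive cells is thin,
-- even this bit is forced, since `pt i` exceeds all of cell i + 1 in its own key. This is why cells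
-- outside the window need only be counted.
--
-- The left end of a fork needs room: a fat cell may use two path points before it. Cell 0 is always
-- a singleton, but cell 1 has only one path point before it. The path therefore starts at the first
-- or at the smallest entry, chosen so that a fat cell 1 still gives a fork or makes cell 2 fat.

Wqo : {A : Set} → (A → A → Set) → Set
Wqo {A} R = (f : ℕ → A) → ∃₂ λ i j → i < j × R (f i) (f j)

infixr 6 _⊗_

data Emb {A B : Set} (R : A → B → Set) : List A → List B → Set where
  nil  : Emb R [] []
  skip : ∀ {y xs ys} → Emb R xs ys → Emb R xs (y ∷ ys)
  keep : ∀ {x y xs ys} → R x y → Emb R xs ys → Emb R (x ∷ xs) (y ∷ ys)

_⊗_ : {A B : Set} → (A → A → Set) → (B → B → Set) → A × B → A × B → Set
(R ⊗ S) (x , y) (x′ , y′) = R x x′ × S y y′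

[]-Emb : ∀ {A B : Set} {R : A → B → Set} ys → Emb R [] ys
[]-Emb []       = nil
[]-Emb (y ∷ ys) = skip ([]-Emb ys)

Emb-map⁻ : ∀ {A B C D : Set} {R : C → D → Set} (g : A → C) (h : B → D) xs ys →
           Emb R (map g xs) (map h ys) → Emb (λ x y → R (g x) (h y)) xs ys
Emb-map⁻ g h []       []       nil        = nil
Emb-map⁻ g h xs       (y ∷ ys) (skip e)   = skip (Emb-map⁻ g h xs ys e)
Emb-map⁻ g h (x ∷ xs) (y ∷ ys) (keep r e) = keep r (Emb-map⁻ g h xs ys e)

Emb⇒map : ∀ {A B : Set} {R : A → B → Set} {xs ys} → Emb R xs ys →
          ∃ λ (φ : Fin (length xs) → Fin (length ys)) →
            (∀ {i j} → i Fin.< j → φ i Fin.< φ j) × (∀ i → R (lookup xs i) (lookup ys (φ i)))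
Emb⇒map nil      = (λ ()) , (λ {}) , λ ()
Emb⇒map (skip e) = let φ , mono , r = Emb⇒map e in
  Fin.suc ∘ φ , (λ i<j → s≤s (mono i<j)) , r
Emb⇒map {xs = x ∷ xs} {y ∷ ys} (keep r₀ e) with Emb⇒map e
... | φ , mono , r = ψ , (λ {i} {j} → ψ-mono i j) , ψ-r
  where
  ψ : Fin (suc (length xs)) → Fin (suc (length ys))
  ψ Fin.zero    = Fin.zero
  ψ (Fin.suc i) = Fin.suc (φ i)
  ψ-mono : ∀ i j → i Fin.< j → ψ i Fin.< ψ j
  ψ-mono Fin.zero    (Fin.suc j) _         = s≤s z≤n
  ψ-mono (Fin.suc i) (Fin.suc j) (s≤s i<j) = s≤s (mono i<j)
  ψ-r : ∀ i → _
  ψ-r Fin.zero    = r₀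
  ψ-r (Fin.suc i) = r i

<-step⇒mono : (h : ℕ → ℕ) → (∀ n → h n < h (suc n)) → ∀ {i j} → i < j → h i < h j
<-step⇒mono h step {i} {suc j} (s≤s i≤j) with m≤n⇒m<n∨m≡n i≤j
... | inj₁ i<j  = <-trans (<-step⇒mono h step i<j) (step j)
... | inj₂ refl = step j

≡-wqo : ∀ {k} → Wqo (_≡_ {A = Fin k})
≡-wqo {k} f =
  let i , j , i<j , eq = Fin.pigeonhole (n<1+n k) (f ∘ toℕ) in toℕ i , toℕ j , i<j , eq

module Classical (em : ExcludedMiddle 0ℓ) where

  ¬¬-elim : {P : Set} → ¬ ¬ P → P
  ¬¬-elim = decidable-stable em

  abstract
    least : (P : ℕ → Set) → ∃ P → ∃ λ n → P n × (∀ m → m < n → ¬ P m)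
    least P (n , p) = <-rec (λ n → P n → ∃ λ n → P n × (∀ m → m < n → ¬ P m)) go n p
      where
      go : ∀ n → (∀ {m} → m < n → P m → ∃ λ n → P n × (∀ m → m < n → ¬ P m)) →
           P n → ∃ λ n → P n × (∀ m → m < n → ¬ P m)
      go n rec p with em {∃ λ m → m < n × P m}
      ... | yes (m , m<n , q) = rec m<n q
      ... | no  none          = n , p , λ m m<n q → none (m , m<n , q)

    least-by : {A : Set} (μ : A → ℕ) (P : A → Set) → ∃ P →
               ∃ λ x → P x × (∀ y → P y → μ x ≤ μ y)
    least-by μ P (x , p) with least (λ n → ∃ λ x → P x × μ x ≡ n) (μ x , x , p , refl)
    ... | _ , (y , q , refl) , min = y , q , λ z r → ≮⇒≥ λ lt → min (μ z) lt (z , r , refl)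

    greatest-by : {A : Set} (μ : A → ℕ) (b : ℕ) (P : A → Set) → (∀ x → P x → μ x ≤ b) → ∃ P →
                  ∃ λ x → P x × (∀ y → P y → μ y ≤ μ x)
    greatest-by μ b P bound ex with least-by (λ x → b ∸ μ x) P ex
    ... | x , p , min = x , p , λ y q → ∸-cancelʳ-≤ (bound y q) (min y q)

  unbounded⇒seq : {P : ℕ → Set} → (∀ N → ∃ λ i → N ≤ i × P i) →
                  ∃ λ h → (∀ {i j} → i < j → h i < h j) × (∀ n → P (h n))
  unbounded⇒seq {P} next = h , <-step⇒mono h (λ n → proj₁ (proj₂ (next (suc (h n))))) , P-h
    where
    h : ℕ → ℕ
    h zero    = proj₁ (next 0)
    h (suc n) = proj₁ (next (suc (h n)))
    P-h : ∀ n → P (h n)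
    P-h zero    = proj₂ (proj₂ (next 0))
    P-h (suc n) = proj₂ (proj₂ (next (suc (h n))))

  -- Infinitely many terminal indices would form a sequence without a good pair. Beyond some `N`
  -- every index thus has a successor that is later and above it; iterating successors and using
  -- transitivity gives the subsequence.
  perfect : {A : Set} {R : A → A → Set} → Wqo R → (∀ {x y z} → R x y → R y z → R x z) →
            (f : ℕ → A) → ∃ λ (g : ℕ → ℕ) → (∀ {i j} → i < j → g i < g j) ×
                                            (∀ {i j} → i < j → R (f (g i)) (f (g j)))
  perfect {A} {R} wqo tr f = g , <-step⇒mono g (proj₁ ∘ g-step) , g-R
    where
    Terminal : ℕ → Set
    Terminal i = ¬ (∃ λ j → i < j × R (f i) (f j))

    fewTerminals : ∃ λ N → ∀ i → N ≤ i → ¬ Terminal i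
    fewTerminals = ¬¬-elim λ none →
      let h , inc , terminal = unbounded⇒seq λ N → ¬¬-elim λ e →
                                 none (N , λ i le t → e (i , le , t))
          i , j , i<j , r    = wqo (f ∘ h)
      in terminal i (h j , inc i<j , r)

    N = proj₁ fewTerminals

    succ : ∀ i → N ≤ i → ∃ λ j → i < j × R (f i) (f j)
    succ i le = ¬¬-elim (proj₂ fewTerminals i le)

    g′ : ℕ → ∃ λ i → N ≤ i
    g′ zero    = N , ≤-refl
    g′ (suc n) with g′ n
    ... | i , le = proj₁ (succ i le) , ≤-trans le (<⇒≤ (proj₁ (proj₂ (succ i le))))

    g : ℕ → ℕ
    g = proj₁ ∘ g′

    g-step : ∀ n → g n < g (suc n) × R (f (g n)) (f (g (suc n)))
    g-step n = proj₂ (succ (g n) (proj₂ (g′ n)))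

    g-R : ∀ {i j} → i < j → R (f (g i)) (f (g j))
    g-R {i} {suc j} (s≤s i≤j) with m≤n⇒m<n∨m≡n i≤j
    ... | inj₁ i<j  = tr (g-R i<j) (proj₂ (g-step j))
    ... | inj₂ refl = proj₂ (g-step j)

  ≤-wqo : Wqo _≤_
  ≤-wqo f with least-by f (λ _ → ⊤) (0 , tt)
  ... | i , _ , min = i , suc i , n<1+n i , min (suc i) tt

  -- On a subsequence along which all first components increase, a good pair of second components is
  -- good for both.
  ⊗-wqo : {A B : Set} {R : A → A → Set} {S : B → B → Set} → Wqo R →
          (∀ {x y z} → R x y → R y z → R x z) → Wqo S →
          Wqo (R ⊗ S)
  ⊗-wqo {R = R} wqoR tr wqoS f with perfect {R = R} wqoR tr (proj₁ ∘ f)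
  ... | g , inc , r with wqoS (proj₂ ∘ f ∘ g)
  ... | i , j , i<j , s = g i , g j , inc i<j , r i<j , s

  -- Higman's lemma by a minimal bad sequence

  module Higman {A : Set} {R : A → A → Set} (wqoR : Wqo R)
                (tr : ∀ {x y z} → R x y → R y z → R x z) where

    Bad : (ℕ → List A) → Set
    Bad f = ∀ {i j} → i < j → ¬ Emb R (f i) (f j)

    Agree : ℕ → (f g : ℕ → List A) → Set
    Agree n f g = ∀ i → i < n → f i ≡ g i

    BadSeq : Set
    BadSeq = ∃ λ (f : ℕ → List A) → Bad f

    minimise : ∀ n ((f , _) : BadSeq) → ∃ λ ((g , _) : BadSeq) → Agree n g f ×
               (∀ ((h , _) : BadSeq) → Agree n h f → length (g n) ≤ length (h n))
    minimise n f = least-by (λ (g , _) → length (g n)) (λ (g , _) → Agree n g (proj₁ f))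
                            (f , λ _ _ → refl)

    module _ (f₀ : BadSeq) where

      F : ℕ → BadSeq
      F zero    = f₀
      F (suc n) = proj₁ (minimise n (F n))

      -- The minimal bad sequence, as a diagonal: entry `n` is final once `F (suc n)` is chosen,
      -- since every later stage changes only entries of larger index.
      G : ℕ → List A
      G n = proj₁ (F (suc n)) n

      F-agree : ∀ n k → Agree n (proj₁ (F (k + n))) (proj₁ (F n))
      F-agree n zero    i i<n = refl
      F-agree n (suc k) i i<n =
        trans (proj₁ (proj₂ (minimise (k + n) (F (k + n)))) i (≤-trans i<n (m≤n+m n k)))
              (F-agree n k i i<n)

      G-F : ∀ n → Agree n G (proj₁ (F n))
      G-F n i i<n with m≤n⇒∃[o]m+o≡n i<n
      ... | k , refl = sym (subst (λ m → proj₁ (F m) i ≡ G i) (+-comm k (suc i))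
                                  (F-agree (suc i) k i (n<1+n i)))

      G-bad : Bad G
      G-bad {i} {j} i<j = subst (λ x → ¬ Emb R x (G j))
        (sym (G-F (suc j) i (m<n⇒m<1+n i<j))) (proj₂ (F (suc j)) i<j)

      G-min : ∀ n (h : BadSeq) → Agree n (proj₁ h) G → length (G n) ≤ length (proj₁ h n)
      G-min n h ag = proj₂ (proj₂ (minimise n (F n))) h λ i i<n → trans (ag i i<n) (G-F n i i<n)

      G-cons : ∀ n → ∃₂ λ x xs → G n ≡ x ∷ xs
      G-cons n with G n in eq
      ... | x ∷ xs = x , xs , refl
      ... | []     = contradiction (subst (λ w → Emb R w (G (suc n))) (sym eq) ([]-Emb _))
                                   (G-bad (n<1+n n))

      hd : ℕ → A
      hd n = proj₁ (G-cons n)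

      tl : ℕ → List A
      tl n = proj₁ (proj₂ (G-cons n))

      G≡ : ∀ n → G n ≡ hd n ∷ tl n
      G≡ n = proj₂ (proj₂ (G-cons n))

      impossible : ⊥
      impossible with perfect {R = R} wqoR tr hd
      ... | g , inc , r = <⇒≱ shorter (G-min m (H , H-bad) agree)
        where
        m : ℕ
        m = g 0

        m≤g : ∀ i → m ≤ g i
        m≤g zero    = ≤-refl
        m≤g (suc i) = <⇒≤ (inc (s≤s z≤n))

        -- H agrees with G before m and is shorter at m, contradicting the minimality of G.
        H : ℕ → List A
        H i with i <? m
        ... | yes _ = G i
        ... | no  _ = tl (g (i ∸ m))

        agree : Agree m H G
        agree i i<m with i <? m
        ... | yes _   = refl
        ... | no  i≮m = contradiction i<m i≮m

        shorter : length (H m) < length (G m)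
        shorter with m <? m
        ... | yes m<m = contradiction m<m (<-irrefl refl)
        ... | no  _   = subst₂ (λ k w → length (tl (g k)) < length w)
                          (sym (n∸n≡0 m)) (sym (G≡ m)) ≤-refl

        H-bad : Bad H
        H-bad {i} {j} i<j e with i <? m | j <? m
        ... | yes _   | yes _   = G-bad i<j e
        ... | no  i≮m | yes j<m = i≮m (<-trans i<j j<m)
        ... | yes i<m | no  _   = G-bad (<-≤-trans i<m (m≤g (j ∸ m)))
                                    (subst (Emb R (G i)) (sym (G≡ _)) (skip e))
        ... | no  i≮m | no  _   = G-bad (inc lt)
                                    (subst₂ (Emb R) (sym (G≡ _)) (sym (G≡ _)) (keep (r lt) e))
          where lt = ∸-monoˡ-< i<j (≮⇒≥ i≮m)

    Emb-wqo : Wqo (Emb R)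
    Emb-wqo f = ¬¬-elim λ none → impossible (f , λ i<j e → none (_ , _ , i<j , e))

-- Staircase cells

-- The type of a point of a permutation tells whether it is a left-to-right maximum (true), K true is
-- its value and K false its position. Exchanging the roles of the types exchanges those of the keys,
-- that is, inverts the permutation; s is the first left-to-right maximum or the first other point.
record Shape (P : Set) : Set₁ where
  field
    t       : P → Bool
    K       : Bool → P → ℕ
    B       : ℕ
    bounded : ∀ b x → K b x ≤ B
    points  : List P
    listed  : ∀ x → x ∈ points
    K-inj   : ∀ b {x y} → K b x ≡ K b y → x ≡ y
    same    : ∀ {x y} b b′ → t x ≡ t y → K b x < K b y → K b′ x < K b′ y
    cross   : ∀ {x y} → t y ≡ not (t x) → K (t y) y < K (t y) x → K (t x) y < K (t x) x
    s s′    : P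
    s-first  : ∀ {x} → x ≢ s → K (not (t s)) s < K (not (t s)) x
    s′-opp   : t s′ ≡ not (t s)
    s′-first : ∀ {x} b → t x ≡ not (t s) → K b s′ ≤ K b x
    s-s′     : K (t s) s′ < K (t s) s
    -- Either s′ is the only neighbour of s, or s is not the only one of s′; this makes fat-1 true.
    start   : (∀ {x} → t x ≡ not (t s) → K (t s) x < K (t s) s → x ≡ s′) ⊎
              (∃ λ r → r ≢ s × t r ≡ t s × K (not (t s)) r < K (not (t s)) s′)
    connected : (D : P → Set) → D s → (∀ {x y} → D x → ¬ D y → ∀ b → K b x < K b y) →
                ∀ x → D x

  -- This is adjacency in the inversion graph.
  Adj : P → P → Set
  Adj x y = t y ≡ not (t x) × K (t y) x < K (t y) y × K (t x) y < K (t x) x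

≡not-sym : ∀ {a b} → b ≡ not a → a ≡ not b
≡not-sym {a} eq = trans (sym (Bool.not-involutive a)) (cong not (sym eq))

same-or-opp : ∀ a b → a ≡ b ⊎ b ≡ not a
same-or-opp false false = inj₁ refl
same-or-opp false true  = inj₂ refl
same-or-opp true  false = inj₂ refl
same-or-opp true  true  = inj₁ refl

m≢1+m : ∀ {m} → m ≢ suc m
m≢1+m eq = 1+n≢n (sym eq)

m≢2+m : ∀ {m} → m ≢ suc (suc m)
m≢2+m {m} eq = m≢1+m+n m (trans eq (cong suc (+-comm 1 m)))

b≢not-b : ∀ {a b : Bool} → b ≡ not a → a ≢ b
b≢not-b eq refl = Bool.not-¬ refl eq

module Stair (em : ExcludedMiddle 0ℓ) {P : Set} (S : Shape P) where
  open Classical em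
  open Shape S

  Adj-sym : ∀ {x y} → Adj x y → Adj y x
  Adj-sym (o , u , d) = ≡not-sym o , d , u

  same≤ : ∀ {x y} b b′ → t x ≡ t y → K b x ≤ K b y → K b′ x ≤ K b′ y
  same≤ b b′ t≡ le with m≤n⇒m<n∨m≡n le
  ... | inj₁ lt = <⇒≤ (same b b′ t≡ lt)
  ... | inj₂ eq = ≤-reflexive (cong (K b′) (K-inj b eq))

  <⊎> : ∀ b {x y} → x ≢ y → K b x < K b y ⊎ K b y < K b x
  <⊎> b x≢y with <-cmp (K b _) (K b _)
  ... | tri< lt _ _ = inj₁ lt
  ... | tri≈ _ eq _ = contradiction (K-inj b eq) x≢y
  ... | tri> _ _ gt = inj₂ gt

  opp-≢ : ∀ {x y} → t y ≡ not (t x) → x ≢ y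
  opp-≢ o refl = b≢not-b o refl

  both : ∀ {x y} → t y ≡ not (t x) → K (t x) x < K (t x) y → ∀ b → K b x < K b y
  both {x} {y} o lt b with same-or-opp (t x) b
  ... | inj₁ refl = lt
  ... | inj₂ eq rewrite trans eq (sym o) with <⊎> (t y) (opp-≢ o)
  ...   | inj₁ r = r
  ...   | inj₂ r = contradiction (cross o r) (<-asym lt)

  record Link (x : P) : Set where
    field
      next : P
      opp  : t next ≡ not (t x)
      down : K (t x) next < K (t x) x
      up   : K (t next) x < K (t next) next
      max  : ∀ {y} b → t y ≡ not (t x) → K (t x) y < K (t x) x → K b y ≤ K b next

  last-below : ∀ x → (∃ λ y → t y ≡ not (t x) × K (t x) y < K (t x) x) →
               ∃ λ z → (t z ≡ not (t x) × K (t x) z < K (t x) x) ×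
                 (∀ {y} b → t y ≡ not (t x) → K (t x) y < K (t x) x → K b y ≤ K b z)
  last-below x ex with greatest-by (K true) B _ (λ y _ → bounded true y) ex
  ... | z , q , max = z , q , λ b o d → same≤ true b (trans o (sym (proj₁ q))) (max _ (o , d))

  link₀ : Link s
  link₀ with last-below s (s′ , s′-opp , s-s′)
  ... | z , (o , d) , max = record { next = z ; opp = o ; down = d ; max = max
    ; up = subst (λ b → K b s < K b z) (sym o) (s-first (λ eq → opp-≢ o (sym eq))) }

  -- The previous point `x` is itself a candidate, so the path never gets stuck; at the far end it
  -- oscillates between two points. The field `up` holds because the last candidate `z` is not
  -- before `x`, and `x` is beyond `next l` in that key.
  link₊ : ∀ {x} (l : Link x) → Link (Link.next l)
  link₊ {x} l with last-below (Link.next l) (x , ≡not-sym (Link.opp l) , Link.up l)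
  ... | z , (o , d) , max = record { next = z ; opp = o ; down = d ; max = max
    ; up = subst (λ b → K b y < K b z) (trans (≡not-sym (Link.opp l)) (sym o))
             (<-≤-trans (Link.down l) (max (t x) (≡not-sym (Link.opp l)) (Link.up l))) }
    where y = Link.next l

  chain : ℕ → Σ P Link
  chain zero    = s , link₀
  chain (suc i) = Link.next (proj₂ (chain i)) , link₊ (proj₂ (chain i))

  abstract
    -- The greedy path: each term is the last neighbour of the previous one.
    pt : ℕ → P
    pt i = proj₁ (chain i)

    pt-0 : pt 0 ≡ s
    pt-0 = refl

    pt-opp : ∀ i → t (pt (suc i)) ≡ not (t (pt i))
    pt-opp i = Link.opp (proj₂ (chain i))

    pt-down : ∀ i → K (t (pt i)) (pt (suc i)) < K (t (pt i)) (pt i)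
    pt-down i = Link.down (proj₂ (chain i))

    pt-up : ∀ i → K (t (pt (suc i))) (pt i) < K (t (pt (suc i))) (pt (suc i))
    pt-up i = Link.up (proj₂ (chain i))

    pt-max : ∀ i {y} b → t y ≡ not (t (pt i)) → K (t (pt i)) y < K (t (pt i)) (pt i) →
             K b y ≤ K b (pt (suc i))
    pt-max i = Link.max (proj₂ (chain i))

  -- An initial segment of one of the two increasing sequences, ending at `pt i`. The cell of a
  -- point is the index of the first such segment that contains it.
  A : ℕ → P → Set
  A i x = t x ≡ t (pt i) × K (t x) x ≤ K (t x) (pt i)

  A-step : ∀ {i x y} → A i x → t y ≡ not (t x) → K (t x) y < K (t x) x → A (suc i) y
  A-step {i} {x} {y} (tx , le) o lt =
    trans o (trans (cong not tx) (sym (pt-opp i))) ,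
    pt-max i (t y) (trans o (cong not tx))
      (subst (λ b → K b y < K b (pt i)) tx (<-≤-trans lt le))

  ¬A⇒< : ∀ {i y} b → t y ≡ t (pt i) → ¬ A i y → K b (pt i) < K b y
  ¬A⇒< {i} {y} b ty ¬a = same (t y) b (sym ty) (≰⇒> λ le → ¬a (ty , le))

  A⇒≤ : ∀ {i x} b → A i x → K b x ≤ K b (pt i)
  A⇒≤ {x = x} b (tx , le) = same≤ (t x) b tx le

  -- A point outside all segments lies beyond every point inside them in both keys: an opposite
  -- point that is smaller in the key of the inner one would be in the next segment by `A-step`.
  -- Connectedness then leaves nothing outside.
  covered : ∀ x → ∃ λ i → A i x
  covered = connected (λ x → ∃ λ i → A i x)
                      (0 , cong t (sym pt-0) , ≤-reflexive (cong (K (t s)) (sym pt-0))) closed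
    where
    closed : ∀ {x y} → ∃ (λ i → A i x) → ¬ ∃ (λ i → A i y) → ∀ b → K b x < K b y
    closed {x} {y} (i , a) ¬a b with same-or-opp (t x) (t y)
    ... | inj₁ eq = ≤-<-trans (A⇒≤ b a) (¬A⇒< b (trans (sym eq) (proj₁ a)) λ a′ → ¬a (i , a′))
    ... | inj₂ o with <⊎> (t x) (opp-≢ o)
    ...   | inj₁ lt = both o lt b
    ...   | inj₂ gt = contradiction (suc i , A-step a o gt) ¬a

  abstract
    c : P → ℕ
    c x = proj₁ (least (λ i → A i x) (covered x))

    c-A : ∀ x → A (c x) x
    c-A x = proj₁ (proj₂ (least (λ i → A i x) (covered x)))

    c-min : ∀ {x i} → i < c x → ¬ A i x
    c-min {x} lt = proj₂ (proj₂ (least (λ i → A i x) (covered x))) _ lt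

  t-c : ∀ x → t x ≡ t (pt (c x))
  t-c x = proj₁ (c-A x)

  c≡⇒t≡ : ∀ {x y} → c x ≡ c y → t x ≡ t y
  c≡⇒t≡ {x} {y} eq = trans (t-c x) (trans (cong (t ∘ pt) eq) (sym (t-c y)))

  c-suc⇒opp : ∀ {x y} → c y ≡ suc (c x) → t y ≡ not (t x)
  c-suc⇒opp {x} {y} eq =
    trans (t-c y) (trans (cong (t ∘ pt) eq) (trans (pt-opp (c x)) (cong not (sym (t-c x)))))

  A-≡c : ∀ {i x} → c x ≡ i → A i x
  A-≡c refl = c-A _

  A₀⇒s : ∀ {x} → A 0 x → x ≡ s
  A₀⇒s {x} (tx , le) = ¬¬-elim λ x≢s →
    <⇒≱ (same (not (t s)) (t x) (trans (cong t (sym pt-0)) (sym tx)) (s-first x≢s))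
        (subst (λ z → K (t x) x ≤ K (t x) z) pt-0 le)

  -- For `c x` = h + 1 the separating point is `pt h`. In the key of `y`, the point `x` is at most
  -- `pt (suc h)`, which is below `pt h`, while `y` has the type of `pt h` and lies beyond it. Cell
  -- 0 contains only `s`, the first point in this key.
  cell-up : ∀ {x y} → c y ≡ suc (c x) → K (t y) x < K (t y) y
  cell-up {x} {y} eq with c x in cx
  ... | zero  = subst₂ (λ z b → K b z < K b y) (sym x≡s)
                  (trans (cong (not ∘ t) (sym x≡s)) (sym o)) (s-first (λ y≡s → opp-≢ o (trans x≡s (sym y≡s))))
    where
    x≡s = A₀⇒s (A-≡c cx)
    o = c-suc⇒opp (trans eq (cong suc (sym cx)))
  ... | suc h = ≤-<-trans (A⇒≤ (t y) (A-≡c cx))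
                  (<-trans (subst (λ b → K b (pt (suc h)) < K b (pt h)) (sym ty) (pt-down h))
                           (¬A⇒< (t y) ty (c-min (subst (h <_) (sym eq) (m<n+m h (s≤s (z≤n {1})))))))
    where
    ty : t y ≡ t (pt h)
    ty = trans (c-suc⇒opp {x} (trans eq (cong suc (sym cx))))
           (trans (cong not (trans (t-c x) (cong (t ∘ pt) cx)))
                  (sym (≡not-sym (pt-opp h))))

  far : ∀ {x y} → suc (c x) < c y → ∀ b → K b x < K b y
  far {x} {y} lt b with same-or-opp (t x) (t y)
  ... | inj₁ eq = ≤-<-trans (A⇒≤ b (c-A x))
                    (¬A⇒< b (trans (sym eq) (t-c x)) (c-min (<-trans (n<1+n _) lt)))
  ... | inj₂ o with <⊎> (t x) (opp-≢ o)
  ...   | inj₁ r = both o r b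
  ...   | inj₂ r = contradiction (A-step (c-A x) o r) (c-min lt)

  cell-down : ∀ {i y} → c y ≡ suc i → K (t (pt i)) y < K (t (pt i)) (pt i)
  cell-down {i} cy = ≤-<-trans (A⇒≤ (t (pt i)) (A-≡c cy)) (pt-down i)

  -- The sequence `pt` continues after the last cell, so a point `x` at least as far out has to be
  -- given. If `pt i` lay in an earlier cell, following the path from there to index `c x` would put
  -- `x` into an earlier segment than its own.
  c-pt : ∀ {x i} → i ≤ c x → c (pt i) ≡ i
  c-pt {x} {i} i≤ with m≤n⇒m<n∨m≡n (≮⇒≥ {i} {c (pt i)} (λ lt → c-min lt (refl , ≤-refl)))
  ... | inj₂ eq = eq
  ... | inj₁ lt with m≤n⇒∃[o]m+o≡n i≤
  ...   | k , e with eq ← trans (+-comm k i) e =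
    contradiction (back (shift k (c-A (pt i))) (subst (λ j → A j x) (sym eq) (c-A x)))
                     (c-min (subst (k + c (pt i) <_) eq (+-monoʳ-< k lt)))
    where
    shift : ∀ k {j i} → A j (pt i) → A (k + j) (pt (k + i))
    shift zero    a = a
    shift (suc k) {j} {i} a = A-step (shift k a) (pt-opp (k + i)) (pt-down (k + i))
    back : ∀ {i j x} → A j (pt i) → A i x → A j x
    back {i} {j} {x} a (tx , le) = trans tx (proj₁ a) , ≤-trans le (A⇒≤ (t x) a)

  -- Consecutive cells interleave in only one key, that of the type of the lower one.
  data R (x y : P) : Set where
    level : c y ≡ c x       → K (t x) x < K (t x) y → R x y
    above : c y ≡ suc (c x) → K (t x) x < K (t x) y → R x y
    below : c x ≡ suc (c y) → K (t y) x < K (t y) y → R x y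

  Close : P → P → Set
  Close x y = c x ≤ suc (c y) × c y ≤ suc (c x)

  Close-sym : ∀ {x y} → Close x y → Close y x
  Close-sym = swap

  R-total : ∀ {x y} → Close x y → x ≢ y → R x y ⊎ R y x
  R-total {x} {y} (p , q) x≢y with m≤n⇒m<n∨m≡n p | m≤n⇒m<n∨m≡n q
  ... | inj₂ e | _ with <⊎> (t y) x≢y
  ...   | inj₁ lt = inj₁ (below e lt)
  ...   | inj₂ gt = inj₂ (above e gt)
  R-total {x} {y} (p , q) x≢y | inj₁ _ | inj₂ e with <⊎> (t x) x≢y
  ...   | inj₁ lt = inj₁ (above e lt)
  ...   | inj₂ gt = inj₂ (below e gt)
  R-total {x} {y} (p , q) x≢y | inj₁ (s≤s l) | inj₁ (s≤s m) with <⊎> (t x) x≢y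
  ...   | inj₁ lt = inj₁ (level (≤-antisym m l) lt)
  ...   | inj₂ gt = inj₂ (level (≤-antisym l m) (same (t x) (t y) (c≡⇒t≡ (≤-antisym m l)) gt))

  -- On the two cells k - 1 and k, `R` is the order of a single key, that of the type of cell k - 1.
  -- Hence it has no cycles there, which is what insertion into a list needs.
  R-key : ∀ {k x y b} → (∀ {z} → c z ≡ k → t z ≡ not b) → c x ≡ k ⊎ suc (c x) ≡ k →
          c y ≡ k ⊎ suc (c y) ≡ k → R x y → K b x < K b y
  R-key {b = b} tk cx cy (level e lt) = same _ b (c≡⇒t≡ (sym e)) lt
  R-key tk (inj₁ refl) (inj₁ e′) (above e lt) = contradiction (trans (sym e′) e) m≢1+m
  R-key tk (inj₁ refl) (inj₂ e′) (above e lt) = contradiction (trans (sym e′) (cong suc e)) m≢2+m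
  R-key {x = x} {y} tk (inj₂ refl) _ (above e lt) =
    subst (λ b → K b x < K b y) (trans (≡not-sym (c-suc⇒opp e)) (sym (≡not-sym (tk e)))) lt
  R-key tk (inj₁ e′) (inj₁ refl) (below e lt) = contradiction (trans (sym e′) e) m≢1+m
  R-key tk (inj₂ e′) (inj₁ refl) (below e lt) = contradiction (trans (sym e′) (cong suc e)) m≢2+m
  R-key {x = x} {y} tk cx (inj₂ refl) (below e lt) =
    subst (λ b → K b x < K b y) (trans (≡not-sym (c-suc⇒opp e)) (sym (≡not-sym (tk e)))) lt

  R-asym : ∀ {x y} → R x y → R y x → ⊥
  R-asym {x} {y} (level e l) (level _ l′)  = <-asym l (same (t y) (t x) (c≡⇒t≡ e) l′)
  R-asym (above _ l)  (below _ l′) = <-asym l l′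
  R-asym (below _ l)  (above _ l′) = <-asym l l′
  R-asym (level e _)  (above e′ _) = m≢1+m (trans e e′)
  R-asym (level e _)  (below e′ _) = m≢1+m (trans (sym e) e′)
  R-asym (above e _)  (level e′ _) = m≢1+m (trans e′ e)
  R-asym (below e _)  (level e′ _) = m≢1+m (trans (sym e′) e)
  R-asym (above e _)  (above e′ _) = m≢2+m (trans e (cong suc e′))
  R-asym (below e _)  (below e′ _) = m≢2+m (trans e (cong suc e′))

  R-level : ∀ {x y} b → c y ≡ c x → R x y → K b x < K b y
  R-level b e (level _ l)  = same _ b (c≡⇒t≡ (sym e)) l
  R-level b e (above e′ _) = contradiction (trans (sym e) e′) m≢1+m
  R-level b e (below e′ _) = contradiction (trans e e′) m≢1+m

  R-above : ∀ {x y} → c y ≡ suc (c x) → R x y → K (t x) x < K (t x) y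
  R-above e (level _ l)  = l
  R-above e (above _ l)  = l
  R-above e (below e′ _) = contradiction (trans e (cong suc e′)) m≢2+m

  R-below : ∀ {x y} → c x ≡ suc (c y) → R x y → K (t y) x < K (t y) y
  R-below e (level e′ _)  = contradiction (trans e′ e) m≢1+m
  R-below e (above e′ _) = contradiction (trans e (cong suc e′)) m≢2+m
  R-below e (below _ l)  = l

  R⇒Close : ∀ {x y} → R x y → Close x y
  R⇒Close (level e _) = ≤-trans (≤-reflexive (sym e)) (n≤1+n _) , ≤-trans (≤-reflexive e) (n≤1+n _)
  R⇒Close (above e _) = ≤-trans (n≤1+n _) (≤-trans (≤-reflexive (sym e)) (n≤1+n _)) , ≤-reflexive e
  R⇒Close (below e _) = ≤-reflexive e , ≤-trans (n≤1+n _) (≤-trans (≤-reflexive (sym e)) (n≤1+n _))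

  -- Pairs two or more cells apart may be listed in either order, because their cell numbers already
  -- determine how they compare.
  Before : P → P → Set
  Before x y = Close x y → R x y

  last-two : ∀ {i k} → i ≤ k → k ≤ suc i → i ≡ k ⊎ suc i ≡ k
  last-two i≤k k≤ with m≤n⇒m<n∨m≡n k≤
  ... | inj₁ (s≤s k≤i) = inj₁ (≤-antisym i≤k k≤i)
  ... | inj₂ eq        = inj₂ (sym eq)

  -- The new point goes right after the last one that must precede it.
  insert : ∀ x W → AllPairs Before W → All (λ w → c w ≤ c x) W → ¬ x ∈ W →
           ∃ λ W′ → AllPairs Before W′ × x ∈ W′ × (∀ {w} → w ∈ W → w ∈ W′) ×
                    (∀ {w} → w ∈ W′ → w ≡ x ⊎ w ∈ W)
  insert x [] [] [] x∉ = x ∷ [] , [] ∷ [] , here refl , (λ ()) , λ { (here eq) → inj₁ eq }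
  insert x (w ∷ W) ap@(w<W ∷ ap′) al@(w≤ ∷ al′) x∉ with em {∃ λ v → v ∈ w ∷ W × R v x}
  ... | no none = x ∷ w ∷ W , All.tabulate before ∷ ap , here refl , there ,
                  λ { (here eq) → inj₁ eq ; (there w∈) → inj₂ w∈ }
    where
    before : ∀ {v} → v ∈ w ∷ W → Before x v
    before v∈ cl with R-total cl (λ { refl → x∉ v∈ })
    ... | inj₁ r = r
    ... | inj₂ r = contradiction (_ , v∈ , r) none
  ... | yes (v , v∈ , vx) with insert x W ap′ al′ (x∉ ∘ there)
  ...   | W′ , ap″ , x∈ , ⊆W′ , W′⊆ =
      w ∷ W′ , All.tabulate before ∷ ap″ , there x∈ ,
      (λ { (here eq) → here eq ; (there w∈) → there (⊆W′ w∈) }) , W∷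
    where
    W∷ : ∀ {u} → u ∈ w ∷ W′ → u ≡ x ⊎ u ∈ w ∷ W
    W∷ (here eq) = inj₂ (here eq)
    W∷ (there u∈) with W′⊆ u∈
    ... | inj₁ eq = inj₁ eq
    ... | inj₂ u∈ = inj₂ (there u∈)
    key : ∀ {y z} → c y ≡ c x ⊎ suc (c y) ≡ c x → c z ≡ c x ⊎ suc (c z) ≡ c x → R y z →
          K (not (t x)) y < K (not (t x)) z
    key = R-key λ cz → trans (c≡⇒t≡ cz) (sym (Bool.not-involutive (t x)))
    wx : Close w x → R w x
    wx cl with R-total cl (λ { refl → x∉ (here refl) })
    ... | inj₁ r  = r
    ... | inj₂ xw = ⊥-elim (cycle v∈)
      where
      -- All of `x`, `w` and `v` lie in the cell of `x` or in the one before it, so a cycle among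
      -- them contradicts the order of one key.
      cycle : ¬ v ∈ w ∷ W
      cycle (here refl) = R-asym xw vx
      cycle (there v∈W) = <-irrefl refl (<-trans (key x₀ w₀ xw) (<-trans (key w₀ v₀ wv) (key v₀ x₀ vx)))
        where
        x₀ : c x ≡ c x ⊎ suc (c x) ≡ c x
        x₀ = inj₁ refl
        w₀ = last-two w≤ (proj₂ cl)
        v≤ = All.lookup al v∈
        v₀ = last-two v≤ (proj₂ (R⇒Close vx))
        wv : R w v
        wv = All.lookup w<W v∈W (≤-trans w≤ (proj₂ (R⇒Close vx)) , ≤-trans v≤ (proj₂ cl))
    before : ∀ {u} → u ∈ W′ → Before w u
    before u∈ with W′⊆ u∈
    ... | inj₁ refl = wx
    ... | inj₂ u∈W  = All.lookup w<W u∈W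

  module _ (a : ℕ) where

    Arranged : ℕ → List P → Set
    Arranged k W = AllPairs Before W × All (λ w → a ≤ c w × c w ≤ k) W

    arrange-cell : ∀ k → a ≤ k → ∀ xs W → Arranged k W →
                   ∃ λ W′ → Arranged k W′ × (∀ {x} → x ∈ xs → c x ≡ k → x ∈ W′) ×
                            (∀ {w} → w ∈ W → w ∈ W′)
    arrange-cell k a≤k [] W ok = W , ok , (λ ()) , λ w∈ → w∈
    arrange-cell k a≤k (x ∷ xs) W ok with arrange-cell k a≤k xs W ok
    ... | V , ok′@(ap , al) , cov , sub with em {c x ≡ k × ¬ x ∈ V}
    ...   | no  nx = V , ok′ , cov′ , sub
      where
      cov′ : ∀ {y} → y ∈ x ∷ xs → c y ≡ k → y ∈ V
      cov′ (here refl) e = ¬¬-elim λ x∉ → nx (e , x∉)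
      cov′ (there y∈)  e = cov y∈ e
    ...   | yes (refl , x∉) with insert x V ap (All.map proj₂ al) x∉
    ...     | V′ , ap′ , x∈ , V⊆ , V′⊆ = V′ , (ap′ , All.tabulate al″) , cov′ , V⊆ ∘ sub
      where
      al″ : ∀ {w} → w ∈ V′ → a ≤ c w × c w ≤ c x
      al″ w∈ with V′⊆ w∈
      ... | inj₁ refl = a≤k , ≤-refl
      ... | inj₂ w∈V  = All.lookup al w∈V
      cov′ : ∀ {y} → y ∈ x ∷ xs → c y ≡ c x → y ∈ V′
      cov′ (here refl) _ = x∈
      cov′ (there y∈)  e = V⊆ (cov y∈ e)

    -- Cells are added in increasing order, as `insert` requires that no listed point is in a higher
    -- cell than the new one.
    arrange : ∀ N → ∃ λ W → Arranged (a + N) W × (∀ {x} → a ≤ c x → c x ≤ a + N → x ∈ W)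
    arrange zero with arrange-cell (a + 0) (m≤m+n a 0) points [] ([] , [])
    ... | W , ok , cov , _ = W , ok , λ {x} a≤ ≤a →
      cov (listed x) (≤-antisym ≤a (≤-trans (≤-reflexive (+-identityʳ a)) a≤))
    arrange (suc N) with arrange N
    ... | V , (ap , al) , cov with arrange-cell (a + suc N) (m≤m+n a (suc N)) points V
           (ap , All.map (λ { (p , q) → p , ≤-trans q (+-monoʳ-≤ a (n≤1+n N)) }) al)
    ...   | W , ok , covW , V⊆ = W , ok , cov′
      where
      cov′ : ∀ {x} → a ≤ c x → c x ≤ a + suc N → x ∈ W
      cov′ {x} p q with m≤n⇒m<n∨m≡n q
      ... | inj₂ eq = covW (listed x) eq
      ... | inj₁ lt = V⊆ (cov p (≤-pred (≤-trans lt (≤-reflexive (+-suc a N)))))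

  Thin : ℕ → Set
  Thin i = ∀ {x} → c x ≡ i → x ≡ pt i

clamp : ∀ N → ℕ → Fin (suc N)
clamp N       zero    = Fin.zero
clamp zero    (suc i) = Fin.zero
clamp (suc N) (suc i) = Fin.suc (clamp N i)

toℕ-clamp : ∀ {N i} → i ≤ N → toℕ (clamp N i) ≡ i
toℕ-clamp {zero}  z≤n     = refl
toℕ-clamp {suc N} z≤n     = refl
toℕ-clamp {suc N} (s≤s p) = cong suc (toℕ-clamp p)

AllPairs-lookup : ∀ {A : Set} {R : A → A → Set} {xs} → AllPairs R xs →
                  ∀ {i j} → i Fin.< j → R (lookup xs i) (lookup xs j)
AllPairs-lookup (p ∷ ps) {Fin.zero}  {Fin.suc j} _         = All.lookup p (∈-lookup j)
AllPairs-lookup (p ∷ ps) {Fin.suc i} {Fin.suc j} (s≤s i<j) = AllPairs-lookup ps i<j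

-- Embedding one staircase into another by comparing their windows

module Window (em : ExcludedMiddle 0ℓ) (N : ℕ) where

  record Frame {P : Set} (S : Shape P) : Set where
    open Stair em S
    field
      a e     : ℕ
      top     : P
      top-c   : c top ≡ a + e
      top-max : ∀ x → c x ≤ a + e
      thin    : ∀ {i} → i < a ⊎ a + N ≤ i → Thin i

    core : List P
    core = proj₁ (arrange a N)

    letter : P → Fin (suc N)
    letter x = clamp N (c x ∸ a)

    type : Bool
    type = Shape.t S (pt a)

    word : List (Fin (suc N))
    word = map letter core

    -- Cell a + N is included although it is thin. It is the overlap of core and path: the image of
    -- its point under a word embedding lands in a thin cell and is therefore a path point again.
    InCore : P → Set
    InCore x = a ≤ c x × c x ≤ a + N

    core-sound : ∀ {x} → x ∈ core → InCore x
    core-sound = All.lookup (proj₂ (proj₁ (proj₂ (arrange a N))))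

    core-complete : ∀ {x} → InCore x → x ∈ core
    core-complete (p , q) = proj₂ (proj₂ (arrange a N)) p q

    core-ordered : ∀ {i j} → i Fin.< j → Before (lookup core i) (lookup core j)
    core-ordered = AllPairs-lookup (proj₁ (proj₁ (proj₂ (arrange a N))))

    toℕ-letter : ∀ {x} → InCore x → a + toℕ (letter x) ≡ c x
    toℕ-letter {x} (p , q) =
      trans (cong (a +_) (toℕ-clamp (m≤n+o⇒m∸n≤o (c x) a q))) (m+[n∸m]≡n p)

  module _ {P P′ : Set} {S : Shape P} {S′ : Shape P′} (F : Frame S) (F′ : Frame S′) where
    private
      module S  = Shape S
      module S′ = Shape S′
      module C  = Stair em S
      module C′ = Stair em S′
      module F  = Frame F
      module F′ = Frame F′

    -- Core points follow the embedding of words, all others are moved along the path by d = a′ - a.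
    -- In both cases the cell number grows by `d`. The bound on `e` keeps the moved path points
    -- within the cells of the larger staircase.
    embed : F.type ≡ F′.type → F.a ≤ F′.a → F.e ≤ F′.e → Emb _≡_ F.word F′.word →
            ∃ λ (f : P → P′) → ∀ b {x y} → S.K b x < S.K b y → S′.K b (f x) < S′.K b (f y)
    embed type≡ a≤ e≤ emb with m≤n⇒∃[o]m+o≡n a≤ | Emb⇒map (Emb-map⁻ F.letter F′.letter F.core F′.core emb)
    ... | d , a+d | φ , φ-mono , φ-letter = f , preserves
      where
      d+a : d + F.a ≡ F′.a
      d+a = trans (+-comm d F.a) a+d

      f : P → P′
      f x with em {F.InCore x}
      ... | yes p = lookup F′.core (φ (index (F.core-complete p)))
      ... | no  _ = C′.pt (d + C.c x)

      f-core : ∀ {x} → F.InCore x → ∃ λ i → lookup F.core i ≡ x × f x ≡ lookup F′.core (φ i)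
      f-core {x} p with em {F.InCore x}
      ... | yes q = index (F.core-complete q) , sym (lookup-index (F.core-complete q)) , refl
      ... | no nq = contradiction p nq

      f-path : ∀ {x} → ¬ F.InCore x → f x ≡ C′.pt (d + C.c x)
      f-path {x} np with em {F.InCore x}
      ... | yes q = contradiction q np
      ... | no  _ = refl

      c-f : ∀ x → C′.c (f x) ≡ d + C.c x
      c-f x with em {F.InCore x}
      ... | no  _ = C′.c-pt {F′.top} (≤-trans (+-monoʳ-≤ d (≤-trans (F.top-max x) (+-monoʳ-≤ F.a e≤)))
                      (≤-reflexive (trans (sym (+-assoc d F.a F′.e))
                         (trans (cong (_+ F′.e) d+a) (sym F′.top-c)))))
      ... | yes p = begin
          C′.c z                          ≡⟨ F′.toℕ-letter (F′.core-sound (∈-lookup (φ i))) ⟨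
          F′.a + toℕ (F′.letter z)        ≡⟨ cong₂ (λ m l → m + toℕ l) (sym d+a) (sym (φ-letter i)) ⟩
          d + F.a + toℕ (F.letter y)      ≡⟨ +-assoc d F.a _ ⟩
          d + (F.a + toℕ (F.letter y))    ≡⟨ cong (d +_) (F.toℕ-letter (F.core-sound (∈-lookup i))) ⟩
          d + C.c y                       ≡⟨ cong (λ y → d + C.c y) (sym (lookup-index (F.core-complete p))) ⟩
          d + C.c x                       ∎
        where
        open ≡-Reasoning
        i = index (F.core-complete p)
        y = lookup F.core i
        z = lookup F′.core (φ i)

      type-shift : ∀ i → S.t (C.pt i) ≡ S′.t (C′.pt (d + i))
      type-shift = up (down F.a (trans type≡ (cong (S′.t ∘ C′.pt) (sym d+a))))
        where
        T : ℕ → Set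
        T i = S.t (C.pt i) ≡ S′.t (C′.pt (d + i))
        next : ∀ i → S′.t (C′.pt (d + suc i)) ≡ not (S′.t (C′.pt (d + i)))
        next i = trans (cong (S′.t ∘ C′.pt) (+-suc d i)) (C′.pt-opp (d + i))
        down : ∀ i → T i → T 0
        down zero    h = h
        down (suc i) h = down i (trans (≡not-sym (C.pt-opp i))
                                       (trans (cong not h) (sym (≡not-sym (next i)))))
        up : T 0 → ∀ i → T i
        up h zero    = h
        up h (suc i) = trans (C.pt-opp i) (trans (cong not (up h i)) (sym (next i)))

      t-f : ∀ x → S′.t (f x) ≡ S.t x
      t-f x = trans (C′.t-c (f x)) (trans (cong (S′.t ∘ C′.pt) (c-f x))
                (sym (trans (C.t-c x) (type-shift (C.c x)))))

      c≡ : ∀ {x y} → C.c y ≡ C.c x → C′.c (f y) ≡ C′.c (f x)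
      c≡ {x} {y} eq = trans (c-f y) (trans (cong (d +_) eq) (sym (c-f x)))

      c-suc : ∀ {x y} → C.c y ≡ suc (C.c x) → C′.c (f y) ≡ suc (C′.c (f x))
      c-suc {x} {y} eq = trans (c-f y) (trans (cong (d +_) eq) (trans (+-suc d _) (cong suc (sym (c-f x)))))

      c-far : ∀ {x y} → suc (C.c x) < C.c y → suc (C′.c (f x)) < C′.c (f y)
      c-far {x} {y} lt = subst₂ _<_ (trans (+-suc d _) (cong suc (sym (c-f x)))) (sym (c-f y))
                                    (+-monoʳ-< d lt)

      c-close : ∀ {x y} → C.Close x y → C′.Close (f x) (f y)
      c-close {x} {y} (p , q) = h y x p , h x y q
        where
        h : ∀ x y → C.c y ≤ suc (C.c x) → C′.c (f y) ≤ suc (C′.c (f x))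
        h x y p = subst₂ _≤_ (sym (c-f y)) (trans (+-suc d _) (cong suc (sym (c-f x))))
                             (+-monoʳ-≤ d p)

      -- Close points of a core are listed in the order of `R`, in the source as in the target, and
      -- `φ` keeps the order of the lists.
      core-R : ∀ {x y} → F.InCore x → F.InCore y → C.R x y → C′.R (f x) (f y)
      core-R {x} {y} p q r with f-core p | f-core q
      ... | i , refl , fi | j , refl , fj with Fin.<-cmp i j
      ...   | tri< i<j _ _ = subst₂ C′.R (sym fi) (sym fj)
                (F′.core-ordered (φ-mono i<j) (subst₂ C′.Close fi fj (c-close (C.R⇒Close r))))
      ...   | tri≈ _ refl _ = contradiction r (λ r → C.R-asym r r)
      ...   | tri> _ _ j<i =
                contradiction (F.core-ordered j<i (C.Close-sym (C.R⇒Close r))) (C.R-asym r)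

      outside : ∀ {x} → ¬ F.InCore x → C.c x < F.a ⊎ F.a + N ≤ C.c x
      outside {x} np with F.a ≤? C.c x
      ... | no  nle = inj₁ (≰⇒> nle)
      ... | yes le with C.c x ≤? F.a + N
      ...   | yes le′ = contradiction (le , le′) np
      ...   | no nle  = inj₂ (<⇒≤ (≰⇒> nle))

      -- Only the lower cell of the pair has to be thin. Below the window this is immediate. At its
      -- top, `x` may be the core point of cell a + N, whose image is a path point because cell a′ +
      -- N is thin too.
      seam : ∀ {x y} → C.c y ≡ suc (C.c x) → ¬ (F.InCore x × F.InCore y) →
             x ≡ C.pt (C.c x) × f x ≡ C′.pt (d + C.c x)
      seam {x} {y} e np = F.thin (proj₁ low) refl , proj₂ low
        where
        low : (C.c x < F.a ⊎ F.a + N ≤ C.c x) × f x ≡ C′.pt (d + C.c x)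
        low with F.a ≤? C.c x | C.c y ≤? F.a + N
        ... | yes le | no nle = inj₂ a+N≤ , F′.thin (inj₂ a′+N≤) (c-f x)
          where
          a+N≤ : F.a + N ≤ C.c x
          a+N≤ = ≤-pred (≤-trans (≰⇒> nle) (≤-reflexive e))
          a′+N≤ : F′.a + N ≤ d + C.c x
          a′+N≤ = ≤-trans (≤-reflexive (trans (cong (_+ N) (sym d+a)) (+-assoc d F.a N)))
                          (+-monoʳ-≤ d a+N≤)
        ... | yes le | yes le′ = contradiction
                ((le , ≤-trans c≤ le′) , (≤-trans le c≤ , le′)) np
          where
          c≤ : C.c x ≤ C.c y
          c≤ = ≤-trans (n≤1+n _) (≤-reflexive (sym e))
        ... | no nle | _ = inj₁ (≰⇒> nle) , f-path (nle ∘ proj₁)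

      R-pres : ∀ {x y} → C.R x y → C′.R (f x) (f y)
      R-pres {x} {y} r with em {F.InCore x × F.InCore y}
      ... | yes (p , q) = core-R p q r
      R-pres {x} {y} r@(C.level e lt) | no np = contradiction (cong (S.K (S.t x)) x≡y) (<⇒≢ lt)
        where
        nx : ¬ F.InCore x
        nx p = np (p , subst (λ k → F.a ≤ k × k ≤ F.a + N) (sym e) p)
        x≡y : x ≡ y
        x≡y = trans (F.thin (outside nx) refl) (sym (F.thin (outside nx) e))
      -- A path point exceeds the whole next cell in its own key. So across a seam this case cannot
      -- occur, and in the next case the required inequality always holds in the target.
      R-pres {x} {y} (C.above e lt) | no np = contradiction lt
        (<-asym (subst (λ z → S.K (S.t z) y < S.K (S.t z) z) (sym (proj₁ (seam e np))) (C.cell-down e)))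
      R-pres {x} {y} (C.below e lt) | no np = C′.below (c-suc e)
        (subst (λ z → S′.K (S′.t z) (f x) < S′.K (S′.t z) z) (sym (proj₂ (seam e (np ∘ swap))))
               (C′.cell-down (trans (c-f x) (trans (cong (d +_) e) (+-suc d _)))))

      preserves : ∀ b {x y} → S.K b x < S.K b y → S′.K b (f x) < S′.K b (f y)
      preserves b {x} {y} lt with <-cmp (C.c x) (C.c y)
      ... | tri≈ _ eq _ = C′.R-level b (c≡ (sym eq))
                            (R-pres (C.level (sym eq) (S.same b (S.t x) (C.c≡⇒t≡ eq) lt)))
      ... | tri< c< _ _ with m≤n⇒m<n∨m≡n c<
      ...   | inj₁ c<< = C′.far (c-far c<<) b
      ...   | inj₂ eq with same-or-opp (S.t x) b
      ...     | inj₁ refl = subst (λ b → S′.K b (f x) < S′.K b (f y)) (t-f x)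
                              (C′.R-above (c-suc (sym eq)) (R-pres (C.above (sym eq) lt)))
      ...     | inj₂ b≡   = subst (λ b → S′.K b (f x) < S′.K b (f y))
                              (trans (t-f y) (trans (C.c-suc⇒opp (sym eq)) (sym b≡)))
                              (C′.cell-up (c-suc (sym eq)))
      preserves b {x} {y} lt | tri> _ _ c> with m≤n⇒m<n∨m≡n c>
      ...   | inj₁ c>> = contradiction lt (<-asym (C.far c>> b))
      ...   | inj₂ eq with same-or-opp (S.t y) b
      ...     | inj₁ refl = subst (λ b → S′.K b (f x) < S′.K b (f y)) (t-f y)
                              (C′.R-below (c-suc (sym eq)) (R-pres (C.below (sym eq) lt)))
      ...     | inj₂ b≡   = contradiction lt (<-asym (subst (λ b → S.K b y < S.K b x)
                              (trans (C.c-suc⇒opp (sym eq)) (sym b≡)) (C.cell-up (sym eq))))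

-- Forks from cells with several points

ForkIn : {P : Set} → (P → P → Set) → ℕ → Set
ForkIn {P} E k = ∃ λ (g : Fin (k + 4) → P) →
  (∀ {u v} → g u ≡ g v → u ≡ v) × (∀ u v → E (g u) (g v) ⇔ Fork k u v)

splice : {A : Set} → ℕ → (f g : ℕ → A) → ℕ → A
splice zero    f g u       = g u
splice (suc k) f g zero    = f 0
splice (suc k) f g (suc u) = splice k (f ∘ suc) g u

splice-< : ∀ {A : Set} {k u} {f g : ℕ → A} → u < k → splice k f g u ≡ f u
splice-< {k = suc k} {zero}  _         = refl
splice-< {k = suc k} {suc u} (s≤s u<k) = splice-< u<k

splice-+ : ∀ {A : Set} k i {f g : ℕ → A} → splice k f g (i + k) ≡ g i
splice-+ zero    i {g = g} = cong g (+-identityʳ i)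
splice-+ (suc k) i {f} {g} = trans (cong (splice (suc k) f g) (+-suc i k)) (splice-+ k i)

module StairFork (em : ExcludedMiddle 0ℓ) {P : Set} (S : Shape P) where
  open Classical em
  open Shape S
  open Stair em S

  Adj⇒consecutive : ∀ {x y} → Adj x y → c y ≡ suc (c x) ⊎ c x ≡ suc (c y)
  Adj⇒consecutive {x} {y} adj@(o , u , d) with <-cmp (c x) (c y)
  ... | tri≈ _ eq _ = contradiction (c≡⇒t≡ eq) (b≢not-b o)
  ... | tri< lt _ _ with m≤n⇒m<n∨m≡n lt
  ...   | inj₁ lt′ = contradiction d (<-asym (far lt′ (t x)))
  ...   | inj₂ eq  = inj₁ (sym eq)
  Adj⇒consecutive {x} {y} adj@(o , u , d) | tri> _ _ gt with m≤n⇒m<n∨m≡n gt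
  ...   | inj₁ gt′ = contradiction u (<-asym (far gt′ (t y)))
  ...   | inj₂ eq  = inj₂ (sym eq)

  Adj-pt : ∀ i → Adj (pt i) (pt (suc i))
  Adj-pt i = pt-opp i , pt-up i , pt-down i

  -- Any two points of cell i + 1 can thus serve as leaves at `pt i`; these become the right end of
  -- a fork.
  Adj-cell : ∀ {i y} → c y ≡ suc i → Adj (pt i) y
  Adj-cell {i} {y} cy = c-suc⇒opp cy′ , cell-up cy′ , cell-down cy
    where cy′ = trans cy (cong suc (sym (c-pt {y} (≤-trans (n≤1+n i) (≤-reflexive (sym cy))))))

  Fat : ℕ → Set
  Fat i = ∃ λ w → c w ≡ i × w ≢ pt i

  module _ (e k : ℕ) (3≤k : 3 ≤ k) where

    -- A left leaf for the path pt e, ..., pt (e + k - 1). Together with 3 ≤ k, the bound `low`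
    -- keeps it at least two cells away from the right leaves in cell e + k, hence not adjacent to
    -- them.
    record Leaf (x : P) : Set where
      field
        low  : c x ≤ suc e
        adj  : Adj (pt e) x
        only : ∀ {i} → i < k → Adj (pt (e + i)) x → i ≡ 0

    module Build {α β γ δ : P} (α≢β : α ≢ β) (γ≢δ : γ ≢ δ) (lα : Leaf α) (lβ : Leaf β)
                 (cγ : c γ ≡ e + k) (cδ : c δ ≡ e + k) where

      c-path : ∀ {i} → i < k → c (pt (e + i)) ≡ e + i
      c-path i<k = c-pt {γ} (≤-trans (+-monoʳ-≤ e (<⇒≤ i<k)) (≤-reflexive (sym cγ)))

      leaf : ℕ → P
      leaf 0 = α
      leaf 1 = β
      leaf 2 = γ
      leaf _ = δ

      g : ℕ → P
      g = splice k (λ i → pt (e + i)) leaf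

      data View : ℕ → Set where
        path : ∀ {i} → i < k → View i
        lft  : ∀ {b} → Leaf (leaf b) → b < 2 → View (b + k)
        rgt  : ∀ {b} → c (leaf b) ≡ e + k → 2 ≤ b → b < 4 → View (b + k)

      view : ∀ {u} → u < k + 4 → View u
      view {u} u< with u <? k
      ... | yes u<k = path u<k
      ... | no  u≮k with m≤n⇒∃[o]m+o≡n (≮⇒≥ u≮k)
      ...   | b , refl with subst View (+-comm b k) ∘ outer b
        where
        outer : ∀ b → b < 4 → View (b + k)
        outer 0 b< = lft lα (s≤s z≤n)
        outer 1 b< = lft lβ (s≤s (s≤s z≤n))
        outer 2 b< = rgt cγ (s≤s (s≤s z≤n)) b<
        outer 3 b< = rgt cδ (s≤s (s≤s z≤n)) b<
        outer (suc (suc (suc (suc b)))) (s≤s (s≤s (s≤s (s≤s ()))))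
      ...     | h = h (+-cancelˡ-< k b 4 u<)

      g-path : ∀ {i} → i < k → g i ≡ pt (e + i)
      g-path = splice-<

      g-leaf : ∀ b → g (b + k) ≡ leaf b
      g-leaf b = splice-+ k b

      left≢right : ∀ {x y} → Leaf x → c y ≡ e + k → suc (c x) < c y
      left≢right lx cy = ≤-trans (s≤s (s≤s (Leaf.low lx))) (≤-trans
        (≤-reflexive (+-comm 3 e)) (≤-trans (+-monoʳ-≤ e 3≤k) (≤-reflexive (sym cy))))

      far⇒¬Adj : ∀ {x y} → suc (c x) < c y → ¬ Adj x y
      far⇒¬Adj lt (_ , _ , d) = <-asym (far lt _) d

      leaf-type : ∀ {x y} → Leaf x → Leaf y → ¬ Adj x y
      leaf-type lx ly (o , _) =
        b≢not-b o (trans (proj₁ (Leaf.adj lx)) (sym (proj₁ (Leaf.adj ly))))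

      0<k : 0 < k
      0<k = ≤-trans (s≤s z≤n) 3≤k

      edge-left : ∀ {b i} → Leaf (leaf b) → b < 2 → i < k → Adj (pt (e + i)) (leaf b) →
                  ForkEdge k i (b + k)
      edge-left {b} l b<2 i<k adj with Leaf.only l i<k adj
      edge-left {0} l b<2 i<k adj | refl = leftA
      edge-left {1} l b<2 i<k adj | refl = leftB
      edge-left {suc (suc b)} l (s≤s (s≤s ())) i<k adj | refl

      edge-right : ∀ {b i} → c (leaf b) ≡ e + k → 2 ≤ b → b < 4 → i < k →
                   Adj (pt (e + i)) (leaf b) → ForkEdge k i (b + k)
      edge-right {b} {i} cb 2≤b b<4 i<k adj = go b 2≤b b<4
        where
        last : pred k ≡ i
        last with Adj⇒consecutive adj
        ... | inj₁ eq = cong pred (+-cancelˡ-≡ e k (suc i)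
                (trans (sym cb) (trans eq (trans (cong suc (c-path i<k)) (sym (+-suc e i))))))
        ... | inj₂ eq = contradiction (≤-trans (≤-reflexive (trans (cong suc (sym cb)) (trans (sym eq) (c-path i<k))))
                          (+-monoʳ-≤ e (<⇒≤ i<k))) (<-irrefl refl)
        go : ∀ b → 2 ≤ b → b < 4 → ForkEdge k i (b + k)
        go 2 _ _ = subst (λ i → ForkEdge k i (2 + k)) last rightA
        go 3 _ _ = subst (λ i → ForkEdge k i (3 + k)) last rightB
        go 1 (s≤s ()) _
        go (suc (suc (suc (suc b)))) _ (s≤s (s≤s (s≤s (s≤s ()))))

      edge-path : ∀ {i j} → i < k → j < k → Adj (pt (e + i)) (pt (e + j)) →
                  ForkEdge k i j ⊎ ForkEdge k j i
      edge-path {i} {j} i<k j<k adj with Adj⇒consecutive adj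
      ... | inj₁ eq with refl ← +-cancelˡ-≡ e j (suc i) (trans (sym (c-path j<k))
                (trans eq (trans (cong suc (c-path i<k)) (sym (+-suc e i))))) = inj₁ (path j<k)
      ... | inj₂ eq with refl ← +-cancelˡ-≡ e i (suc j) (trans (sym (c-path i<k))
                (trans eq (trans (cong suc (c-path j<k)) (sym (+-suc e j))))) = inj₂ (path i<k)

      g⇒edge : ∀ {u v} → View u → View v → Adj (g u) (g v) → ForkEdge k u v ⊎ ForkEdge k v u
      g⇒edge (path p) (path q) adj = edge-path p q (subst₂ Adj (g-path p) (g-path q) adj)
      g⇒edge (path p) (lft {b} l b<) adj = inj₁ (edge-left l b< p (subst₂ Adj (g-path p) (g-leaf b) adj))
      g⇒edge (path p) (rgt {b} cb l h) adj = inj₁ (edge-right cb l h p (subst₂ Adj (g-path p) (g-leaf b) adj))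
      g⇒edge (lft {b} l b<) (path p) adj =
        inj₂ (edge-left l b< p (Adj-sym (subst₂ Adj (g-leaf b) (g-path p) adj)))
      g⇒edge (rgt {b} cb l h) (path p) adj =
        inj₂ (edge-right cb l h p (Adj-sym (subst₂ Adj (g-leaf b) (g-path p) adj)))
      g⇒edge (lft {b} l _) (lft {b′} l′ _) adj =
        contradiction (subst₂ Adj (g-leaf b) (g-leaf b′) adj) (leaf-type l l′)
      g⇒edge (lft {b} l _) (rgt {b′} cb _ _) adj =
        contradiction (subst₂ Adj (g-leaf b) (g-leaf b′) adj) (far⇒¬Adj (left≢right l cb))
      g⇒edge (rgt {b} cb _ _) (lft {b′} l _) adj =
        contradiction (Adj-sym (subst₂ Adj (g-leaf b) (g-leaf b′) adj)) (far⇒¬Adj (left≢right l cb))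
      g⇒edge (rgt {b} cb _ _) (rgt {b′} cb′ _ _) adj =
        contradiction (c≡⇒t≡ (trans cb (sym cb′)))
                      (b≢not-b (proj₁ (subst₂ Adj (g-leaf b) (g-leaf b′) adj)))

      last-adj : ∀ {x} → c x ≡ e + k → Adj (pt (e + pred k)) x
      last-adj {x} cx = Adj-cell (trans cx (trans (cong (e +_) (sym (suc-pred k ⦃ >-nonZero 0<k ⦄)))
                                                  (+-suc e (pred k))))

      pred-k<k : pred k < k
      pred-k<k = ≤-reflexive (suc-pred k ⦃ >-nonZero 0<k ⦄)

      edge⇒g : ∀ {u v} → ForkEdge k u v → Adj (g u) (g v)
      edge⇒g {u} (path lt) = subst₂ Adj (sym (g-path (<-trans (n<1+n u) lt)))
        (trans (cong pt (sym (+-suc e u))) (sym (g-path lt))) (Adj-pt (e + u))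
      edge⇒g leftA  = subst₂ Adj (trans (cong pt (sym (+-identityʳ e))) (sym (g-path 0<k)))
                                 (sym (g-leaf 0)) (Leaf.adj lα)
      edge⇒g leftB  = subst₂ Adj (trans (cong pt (sym (+-identityʳ e))) (sym (g-path 0<k)))
                                 (sym (g-leaf 1)) (Leaf.adj lβ)
      edge⇒g rightA = subst₂ Adj (sym (g-path pred-k<k)) (sym (g-leaf 2)) (last-adj cγ)
      edge⇒g rightB = subst₂ Adj (sym (g-path pred-k<k)) (sym (g-leaf 3)) (last-adj cδ)

      path≢left : ∀ {i x} → i < k → Leaf x → pt (e + i) ≢ x
      path≢left {zero} i<k l eq =
        contradiction (trans (cong pt (sym (+-identityʳ e))) eq) (opp-≢ (proj₁ (Leaf.adj l)))
      -- Since 3 ≤ k, the path contains pt (e + 2), a neighbour of pt (e + 1) that a leaf is not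
      -- allowed to have.
      path≢left {suc zero} i<k l refl with Leaf.only l 3≤k
        (subst (λ z → Adj (pt z) (pt (e + 1))) (sym (+-suc e 1)) (Adj-sym (Adj-pt (e + 1))))
      ... | ()
      path≢left {suc (suc h)} i<k l refl = contradiction (Leaf.low l)
        (<⇒≱ (≤-trans (≤-reflexive (+-comm 2 e)) (≤-trans (+-monoʳ-≤ e (s≤s (s≤s z≤n)))
                                                         (≤-reflexive (sym (c-path i<k))))))

      path≢right : ∀ {i x} → i < k → c x ≡ e + k → pt (e + i) ≢ x
      path≢right {i} i<k cx refl = <⇒≢ i<k (+-cancelˡ-≡ e i k (trans (sym (c-path i<k)) cx))

      g-inj : ∀ {u v} → View u → View v → g u ≡ g v → u ≡ v
      g-inj {u} {v} (path p) (path q) eq = +-cancelˡ-≡ e u v (trans (sym (c-path p))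
        (trans (cong c (trans (sym (g-path p)) (trans eq (g-path q)))) (c-path q)))
      g-inj (path p) (lft {b} l _) eq =
        contradiction (trans (sym (g-path p)) (trans eq (g-leaf b))) (path≢left p l)
      g-inj (lft {b} l _) (path p) eq =
        contradiction (trans (sym (g-path p)) (trans (sym eq) (g-leaf b))) (path≢left p l)
      g-inj (path p) (rgt {b} cb _ _) eq =
        contradiction (trans (sym (g-path p)) (trans eq (g-leaf b))) (path≢right p cb)
      g-inj (rgt {b} cb _ _) (path p) eq =
        contradiction (trans (sym (g-path p)) (trans (sym eq) (g-leaf b))) (path≢right p cb)
      g-inj (lft {b} l _) (rgt {b′} cb _ _) eq =
        contradiction (cong c (trans (sym (g-leaf b)) (trans eq (g-leaf b′))))
                      (<⇒≢ (<-trans (n<1+n _) (left≢right l cb)))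
      g-inj (rgt {b} cb _ _) (lft {b′} l _) eq =
        contradiction (cong c (trans (sym (g-leaf b′)) (trans (sym eq) (g-leaf b))))
                      (<⇒≢ (<-trans (n<1+n _) (left≢right l cb)))
      g-inj (lft {b} _ b<) (lft {b′} _ b′<) eq =
        cong (_+ k) (inj b b′ b< b′< (trans (sym (g-leaf b)) (trans eq (g-leaf b′))))
        where
        inj : ∀ b b′ → b < 2 → b′ < 2 → leaf b ≡ leaf b′ → b ≡ b′
        inj 0 0 _ _ _  = refl
        inj 1 1 _ _ _  = refl
        inj 0 1 _ _ eq = contradiction eq α≢β
        inj 1 0 _ _ eq = contradiction (sym eq) α≢β
        inj (suc (suc b)) _ (s≤s (s≤s ())) _ _
        inj _ (suc (suc b)) _ (s≤s (s≤s ())) _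
      g-inj (rgt {b} _ 2≤ b<) (rgt {b′} _ 2≤′ b′<) eq =
        cong (_+ k) (inj b b′ 2≤ b< 2≤′ b′< (trans (sym (g-leaf b)) (trans eq (g-leaf b′))))
        where
        inj : ∀ b b′ → 2 ≤ b → b < 4 → 2 ≤ b′ → b′ < 4 → leaf b ≡ leaf b′ → b ≡ b′
        inj 2 2 _ _ _ _ _  = refl
        inj 3 3 _ _ _ _ _  = refl
        inj 2 3 _ _ _ _ eq = contradiction eq γ≢δ
        inj 3 2 _ _ _ _ eq = contradiction (sym eq) γ≢δ
        inj 1 _ (s≤s ()) _ _ _ _
        inj _ 1 _ _ (s≤s ()) _ _
        inj (suc (suc (suc (suc b)))) _ _ (s≤s (s≤s (s≤s (s≤s ())))) _ _ _
        inj _ (suc (suc (suc (suc b)))) _ _ _ (s≤s (s≤s (s≤s (s≤s ())))) _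

      fork : ForkIn Adj k
      fork = g ∘ toℕ ,
        (λ {u} {v} eq → Fin.toℕ-injective (g-inj (view (Fin.toℕ<n u)) (view (Fin.toℕ<n v)) eq)) ,
        λ u v → mk⇔ (g⇒edge (view (Fin.toℕ<n u)) (view (Fin.toℕ<n v)))
                    (Sum.[ edge⇒g , Adj-sym ∘ edge⇒g ])

  -- On the left, the fork starts at pt (i + 1) with leaves w and pt i if w is adjacent to pt (i + 1), and
  -- otherwise at pt (i - 1) with leaves w and pt (i - 2). On the right, it ends at pt (j - 1) with leaves
  -- in cell j.
  fat-fork : ∀ {i j} → Fat j → 4 + i ≤ j →
             (∃ λ w → c w ≡ i × w ≢ pt i × Adj w (pt (suc i))) ⊎ (2 ≤ i × Fat i) →
             ∃ λ k → 3 ≤ k × j ≤ k + suc i × ForkIn Adj k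
  fat-fork {i} {j} (v , cv , v≢) 4+i≤j (inj₁ (w , cw , w≢ , adj))
    with m≤n⇒∃[o]m+o≡n (≤-trans (s≤s (m≤n+m i 3)) 4+i≤j)
  ... | k , refl = k , 3≤k , ≤-reflexive (+-comm (suc i) k) ,
    Build.fork (suc i) k 3≤k w≢ v≢ lw lp cv (c-pt {v} (≤-reflexive (sym cv)))
    where
    3≤k : 3 ≤ k
    3≤k = +-cancelˡ-≤ (suc i) 3 k (≤-trans (≤-reflexive (+-comm (suc i) 3)) 4+i≤j)
    mk : ∀ {x} → c x ≡ i → Adj x (pt (suc i)) → Leaf (suc i) k 3≤k x
    mk {x} cx adj = record
      { low  = ≤-trans (≤-reflexive cx) (≤-trans (n≤1+n i) (n≤1+n _))
      ; adj  = Adj-sym adj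
      ; only = only }
      where
      only : ∀ {h} → h < k → Adj (pt (suc i + h)) x → h ≡ 0
      only {h} h<k a with Adj⇒consecutive a
           | c-pt {v} {suc i + h} (≤-trans (+-monoʳ-≤ (suc i) (<⇒≤ h<k)) (≤-reflexive (sym cv)))
      ... | inj₁ eq | cp = contradiction (trans (sym cx) (trans eq (cong suc cp)))
              (λ e → m≢1+m+n i (trans e (cong suc (sym (+-suc i h)))))
      ... | inj₂ eq | cp = +-cancelˡ-≡ i h 0
              (trans (suc-injective (trans (sym cp) (trans eq (cong suc cx)))) (sym (+-identityʳ i)))
    lw = mk cw adj
    lp = mk (c-pt {v} (≤-trans (m≤n+m i (4)) (≤-trans 4+i≤j (≤-reflexive (sym cv))))) (Adj-pt i)
  fat-fork {suc (suc h)} {j} (v , cv , v≢) 4+i≤j (inj₂ (s≤s (s≤s _) , w , cw , w≢))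
    with em {Adj w (pt (3 + h))}
  ... | yes adj = fat-fork (v , cv , v≢) 4+i≤j (inj₁ (w , cw , w≢ , adj))
  ... | no ¬adj with m≤n⇒∃[o]m+o≡n (≤-trans (s≤s (m≤n+m h 5)) 4+i≤j)
  ...   | k , refl = k , 3≤k , ≤-trans (≤-reflexive (+-comm (suc h) k)) (+-monoʳ-≤ k (s≤s (m≤n+m h 2))) ,
    Build.fork (suc h) k 3≤k (λ { refl → contradiction (trans (sym cw) ch) 2+h≢h }) v≢ lw lp cv
               (c-pt {v} (≤-reflexive (sym cv)))
    where
    3≤k : 3 ≤ k
    3≤k = +-cancelˡ-≤ (suc h) 3 k (≤-trans (≤-reflexive (+-comm (suc h) 3))
                                           (≤-trans (m≤n+m (4 + h) 2) 4+i≤j))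
    2+h≢h : 2 + h ≢ h
    2+h≢h e = m≢2+m (sym e)
    c-path : ∀ {g} → g ≤ suc h + k → c (pt g) ≡ g
    c-path le = c-pt {v} (≤-trans le (≤-reflexive (sym cv)))
    ch : c (pt h) ≡ h
    ch = c-path (≤-trans (n≤1+n h) (m≤m+n (suc h) k))
    lw : Leaf (suc h) k 3≤k w
    lw = record { low = ≤-reflexive cw ; adj = Adj-cell cw ; only = only }
      where
      only : ∀ {g} → g < k → Adj (pt (suc h + g)) w → g ≡ 0
      only {g} g<k a with Adj⇒consecutive a | c-path (+-monoʳ-≤ (suc h) (<⇒≤ g<k))
      ... | inj₁ eq | cp = +-cancelˡ-≡ h g 0 (trans (sym (suc-injective (suc-injective
                             (trans (sym cw) (trans eq (cong suc cp)))))) (sym (+-identityʳ h)))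
      ... | inj₂ eq | cp = contradiction
              (Adj-sym (subst (λ z → Adj (pt z) w) (trans (sym cp) (trans eq (cong suc cw))) a)) ¬adj
    lp : Leaf (suc h) k 3≤k (pt h)
    lp = record { low = ≤-trans (≤-reflexive ch) (m≤n+m h 2) ; adj = Adj-sym (Adj-pt h) ; only = only }
      where
      only : ∀ {g} → g < k → Adj (pt (suc h + g)) (pt h) → g ≡ 0
      only {g} g<k a with Adj⇒consecutive a | c-path (+-monoʳ-≤ (suc h) (<⇒≤ g<k))
      ... | inj₁ eq | cp = contradiction (trans (sym ch) (trans eq (cong suc cp)))
                             (λ e → m≢1+m+n h (trans e (cong suc (sym (+-suc h g)))))
      ... | inj₂ eq | cp = +-cancelˡ-≡ h g 0 (trans (suc-injective (trans (sym cp) (trans eq (cong suc ch))))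
                                                    (sym (+-identityʳ h)))

  s′-cell : c s′ ≡ 1
  s′-cell with least-cell
    where
    least-cell : c s′ ≤ 1
    least-cell = ≮⇒≥ λ lt → c-min lt (A-step {0} (cong t (sym pt-0) , ≤-reflexive (cong (K (t s)) (sym pt-0)))
                                             s′-opp s-s′)
  ... | le with c s′ in eq
  ...   | 0 = contradiction (A₀⇒s (A-≡c eq)) (λ e → opp-≢ s′-opp (sym e))
  ...   | 1 = refl
  ...   | suc (suc _) = contradiction le λ { (s≤s ()) }

  thin-0 : Thin 0
  thin-0 e = trans (A₀⇒s (A-≡c e)) (sym pt-0)

  -- Here the choice of `s` pays off. If `s′` is the only neighbour of `s`, cell 1 is a singleton.
  -- Otherwise either `s′`, the first point of its type, is adjacent to `pt 2`, or `pt 2` lies so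
  -- far out that `r` shares cell 2 with it.
  fat-1 : Fat 1 → (∃ λ w → c w ≡ 1 × w ≢ pt 1 × Adj w (pt 2)) ⊎ Fat 2
  fat-1 (w , cw , w≢) with start
  ... | inj₁ unique = contradiction (trans (unique t-w w<s) (sym (unique t-1 1<s))) w≢
    where
    cs : c (pt 0) ≡ 0
    cs = c-pt {s} z≤n
    t-w : t w ≡ not (t s)
    t-w = subst (λ z → t w ≡ not (t z)) pt-0 (c-suc⇒opp (trans cw (cong suc (sym cs))))
    t-1 : t (pt 1) ≡ not (t s)
    t-1 = subst (λ z → t (pt 1) ≡ not (t z)) pt-0 (pt-opp 0)
    w<s : K (t s) w < K (t s) s
    w<s = subst (λ z → K (t z) w < K (t z) z) pt-0 (cell-down cw)
    1<s : K (t s) (pt 1) < K (t s) s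
    1<s = subst (λ z → K (t z) (pt 1) < K (t z) z) pt-0 (pt-down 0)
  ... | inj₂ (r , r≢s , tr , r<s′) with em {Adj s′ (pt 2)}
  ...   | yes adj = inj₁ (s′ , s′-cell , s′≢ , adj)
    where
    t-w : t w ≡ not (t s)
    t-w = trans (c≡⇒t≡ (trans cw (sym s′-cell))) s′-opp
    s′≢ : s′ ≢ pt 1
    s′≢ eq = w≢ (K-inj true (≤-antisym (A⇒≤ true (A-≡c cw))
               (≤-trans (≤-reflexive (cong (K true) (sym eq))) (s′-first true t-w))))
  ...   | no ¬adj = inj₂ (r , ≤-antisym (≮⇒≥ λ lt → c-min lt Ar) (≮⇒≥ λ lt → ¬low lt refl) ,
                        λ { refl → <-irrefl refl r<2 })
    where
    t-2 : t (pt 2) ≡ t s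
    t-2 = trans (pt-opp 1) (trans (cong not (pt-opp 0)) (trans (Bool.not-involutive _) (cong t pt-0)))
    opp-2 : t (pt 2) ≡ not (t s′)
    opp-2 = trans t-2 (≡not-sym s′-opp)
    s′<2 : K (t (pt 2)) s′ < K (t (pt 2)) (pt 2)
    s′<2 = <-≤-trans (subst (λ b → K b s′ < K b s) (sym t-2) s-s′)
      (subst (λ z → K (t (pt 2)) z ≤ K (t (pt 2)) (pt 2)) pt-0
             (pt-max 1 _ (≡not-sym (pt-opp 0)) (pt-up 0)))
    r<2 : K (t s′) r < K (t s′) (pt 2)
    r<2 = <-≤-trans (subst (λ b → K b r < K b s′) (sym s′-opp) r<s′)
                    (≮⇒≥ λ lt → ¬adj (opp-2 , s′<2 , lt))
    Ar : A 2 r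
    Ar = trans tr (sym t-2) , <⇒≤ (same (t s′) (t r) (trans tr (sym t-2)) r<2)
    ¬low : ∀ {i} → i < 2 → c r ≢ i
    ¬low {0} _ e = r≢s (A₀⇒s (A-≡c e))
    ¬low {1} _ e = b≢not-b (trans (sym tr) (trans (proj₁ (A-≡c e)) (trans (pt-opp 0) (cong (not ∘ t) pt-0)))) refl
    ¬low {suc (suc _)} (s≤s (s≤s ())) _

  -- Fat cells at distance at least K₀ + 4 give a fork that is too long, the 4 being the distance
  -- that `fat-fork` asks for in any case. One more cell is lost when a fat cell 1 merely produces a
  -- fat cell 2, hence K₀ + 5. The window starts at the least fat cell.
  fat-window : ∀ {K₀} → (∀ k → K₀ ≤ k → ¬ ForkIn Adj k) →
               ∃ λ a → (∃ λ x → c x ≡ a) × (∀ {i} → i < a ⊎ a + (K₀ + 5) ≤ i → Thin i)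
  fat-window {K₀} noFork with em {∃ Fat}
  ... | no none = 0 , (pt 0 , c-pt {s} z≤n) , λ _ e → ¬¬-elim λ x≢ → none (_ , _ , e , x≢)
  ... | yes fat with least Fat fat
  ...   | a , (w , cw , w≢) , min = a , (w , cw) , thin
    where
    spread : ∀ i {j} → i + (K₀ + 4) ≤ j → Fat j →
             ¬ ((∃ λ w → c w ≡ i × w ≢ pt i × Adj w (pt (suc i))) ⊎ (2 ≤ i × Fat i))
    spread i {j} le fj hi 
      with fat-fork fj (≤-trans (≤-reflexive (+-comm 4 i)) (≤-trans (+-monoʳ-≤ i (m≤n+m 4 K₀)) le)) hi
    ... | k , _ , j≤ , fk = noFork k (≤-trans (m≤m+n K₀ 3) (+-cancelˡ-≤ (suc i) (K₀ + 3) k (begin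
      suc i + (K₀ + 3)  ≡⟨ sym (+-suc i (K₀ + 3)) ⟩
      i + suc (K₀ + 3)  ≡⟨ cong (i +_) (sym (+-suc K₀ 3)) ⟩
      i + (K₀ + 4)      ≤⟨ le ⟩
      j                 ≤⟨ j≤ ⟩
      k + suc i         ≡⟨ +-comm k (suc i) ⟩
      suc i + k         ∎))) fk
      where open ≤-Reasoning
    later : ∀ a {j} → a + (K₀ + 5) ≤ j → Fat a → ¬ Fat j
    later 0 le (x , cx , x≢) fj = x≢ (thin-0 cx)
    later 1 le fa fj with fat-1 fa
    ... | inj₁ h = spread 1 (≤-trans (s≤s (+-monoʳ-≤ K₀ (n≤1+n 4))) le) fj (inj₁ h)
    ... | inj₂ h = spread 2 (≤-trans (≤-reflexive (cong suc (sym (+-suc K₀ 4)))) le) fj (inj₂ (s≤s (s≤s z≤n) , h))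
    later a@(suc (suc _)) le fa fj =
      spread a (≤-trans (+-monoʳ-≤ a (+-monoʳ-≤ K₀ (n≤1+n 4))) le) fj (inj₂ (s≤s (s≤s z≤n) , fa))
    thin : ∀ {i} → i < a ⊎ a + (K₀ + 5) ≤ i → Thin i
    thin (inj₁ i<a) e = ¬¬-elim λ x≢ → min _ i<a (_ , e , x≢)
    thin (inj₂ le)  e = ¬¬-elim λ x≢ → later a le (w , cw , w≢) (_ , e , x≢)

-- Lists as shapes

lookup-injective : ∀ {A : Set} {xs : List A} → Unique xs →
                   ∀ {i j : Fin (length xs)} → lookup xs i ≡ lookup xs j → i ≡ j
lookup-injective (_ ∷ _)  {Fin.zero}  {Fin.zero}  _  = refl
lookup-injective (x ∷ _)  {Fin.zero}  {Fin.suc j} eq = contradiction eq (All.lookup x (∈-lookup j))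
lookup-injective (x ∷ _)  {Fin.suc i} {Fin.zero}  eq = contradiction (sym eq) (All.lookup x (∈-lookup i))
lookup-injective (_ ∷ xs) {Fin.suc i} {Fin.suc j} eq = cong Fin.suc (lookup-injective xs eq)

lookup≤sum : ∀ (xs : List ℕ) i → lookup xs i ≤ sum xs
lookup≤sum (x ∷ xs) Fin.zero    = m≤m+n x (sum xs)
lookup≤sum (x ∷ xs) (Fin.suc i) = ≤-trans (lookup≤sum xs i) (m≤n+m (sum xs) x)

All-take : ∀ {A : Set} {P : A → Set} (xs : List A) k →
           (∀ i → toℕ i < k → P (lookup xs i)) → All P (take k xs)
All-take xs       zero    h = []
All-take []       (suc k) h = []
All-take (x ∷ xs) (suc k) h = h Fin.zero (s≤s z≤n) ∷ All-take xs k (λ i i<k → h (Fin.suc i) (s≤s i<k))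

All-drop : ∀ {A : Set} {P : A → Set} (xs : List A) k →
           (∀ i → k ≤ toℕ i → P (lookup xs i)) → All P (drop k xs)
All-drop {P = P} xs zero  h = All.tabulate λ {x} x∈ → subst P (sym (lookup-index x∈)) (h (index x∈) z≤n)
All-drop []       (suc k) h = []
All-drop (x ∷ xs) (suc k) h = All-drop xs k (λ i k≤i → h (Fin.suc i) (s≤s k≤i))

Distinct : List ℕ → Set
Distinct xs = ∀ {i j} → lookup xs i ≡ lookup xs j → i ≡ j

_≪_ : List ℕ → List ℕ → Set
xs ≪ ys = All (λ x → All (x <_) ys) xs

Indecomposable : List ℕ → Set
Indecomposable xs = ∀ ys zs → xs ≡ ys ++ zs → ys ≢ [] → zs ≢ [] → ¬ ys ≪ zs

Avoids321 : List ℕ → Set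
Avoids321 xs = ∀ {i j k} → i <ᶠ j → j <ᶠ k → ¬ (lookup xs k < lookup xs j × lookup xs j < lookup xs i)

key : (xs : List ℕ) → Bool → Fin (length xs) → ℕ
key xs true  i = lookup xs i
key xs false i = toℕ i

module _ (em : ExcludedMiddle 0ℓ) (x₀ x₁ : ℕ) (xs₀ : List ℕ) where
  open Classical em
  private
    xs : List ℕ
    xs = x₀ ∷ x₁ ∷ xs₀
    n : ℕ
    n = length xs
    V : Fin n → ℕ
    V = lookup xs

  LRMax : Fin n → Set
  LRMax i = ∀ j → j <ᶠ i → V j < V i

  upper : Fin n → Bool
  upper i = ⌊ em {LRMax i} ⌋

  upper⇒LRMax : ∀ {i} → upper i ≡ true → LRMax i
  upper⇒LRMax {i} eq with em {LRMax i}
  upper⇒LRMax {i} _  | yes p = p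
  upper⇒LRMax {i} () | no _

  lower⇒¬LRMax : ∀ {i} → upper i ≡ false → ¬ LRMax i
  lower⇒¬LRMax {i} eq with em {LRMax i}
  lower⇒¬LRMax {i} () | yes p
  lower⇒¬LRMax {i} _  | no np = np

  upper-or-lower : ∀ i → upper i ≡ true ⊎ upper i ≡ false
  upper-or-lower i with upper i
  ... | true  = inj₁ refl
  ... | false = inj₂ refl

  module _ (V-inj : Distinct xs) (av : Avoids321 xs) where

    K-injective : ∀ b {i j} → key xs b i ≡ key xs b j → i ≡ j
    K-injective true  = V-inj
    K-injective false = Fin.toℕ-injective

    -- If two points that are not left-to-right maxima formed a descent, a larger entry before the
    -- first of them would complete a 321.
    mono : ∀ {i j} → upper i ≡ upper j → i <ᶠ j → V i < V j
    mono {i} {j} eq i<j with upper-or-lower j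
    ... | inj₁ u = upper⇒LRMax u i i<j
    ... | inj₂ l with <-cmp (V i) (V j)
    ...   | tri< lt _ _ = lt
    ...   | tri≈ _ e _ = contradiction (cong toℕ (V-inj e)) (<⇒≢ i<j)
    ...   | tri> _ _ gt = ⊥-elim (lower⇒¬LRMax (trans eq l) λ h h<i → ≰⇒> λ le →
              av h<i i<j (gt , ≤∧≢⇒< le λ e → <⇒≢ h<i (cong toℕ (sym (V-inj e)))))

    mono⁻ : ∀ {i j} → upper i ≡ upper j → V i < V j → i <ᶠ j
    mono⁻ {i} {j} eq lt with Fin.<-cmp i j
    ... | tri< r _ _    = r
    ... | tri≈ _ refl _ = contradiction lt (<-irrefl refl)
    ... | tri> _ _ r    = contradiction (mono (sym eq) r) (<-asym lt)

    same-key : ∀ {i j} b b′ → upper i ≡ upper j → key xs b i < key xs b j → key xs b′ i < key xs b′ j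
    same-key true  true  e lt = lt
    same-key true  false e lt = mono⁻ e lt
    same-key false true  e lt = mono e lt
    same-key false false e lt = lt

    cross-key : ∀ {i j} → upper j ≡ not (upper i) → key xs (upper j) j < key xs (upper j) i →
                key xs (upper i) j < key xs (upper i) i
    cross-key {i} {j} o lt with upper-or-lower i
    ... | inj₁ u rewrite o | u = upper⇒LRMax u j lt
    ... | inj₂ l rewrite l | o with Fin.<-cmp i j
    ...   | tri< i<j _ _  = contradiction (upper⇒LRMax o i i<j) (<-asym lt)
    ...   | tri≈ _ refl _ = contradiction lt (<-irrefl refl)
    ...   | tri> _ _ j<i  = j<i

    Inv⇒types : ∀ {i j} → i <ᶠ j → V j < V i → upper i ≡ true × upper j ≡ false
    Inv⇒types {i} {j} i<j lt with upper-or-lower j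
    ... | inj₁ u = contradiction (upper⇒LRMax u i i<j) (<-asym lt)
    ... | inj₂ l with upper-or-lower i
    ...   | inj₁ u  = u , l
    ...   | inj₂ l′ = contradiction (mono (trans l′ (sym l)) i<j) (<-asym lt)

    upper-zero : upper Fin.zero ≡ true
    upper-zero with em {LRMax Fin.zero}
    ... | yes _ = refl
    ... | no np = contradiction (λ j ()) np

    module _ (ind : Indecomposable xs) where

      -- The first index outside `D` cuts the list: all indices before it are in `D` and all from it
      -- on are outside, so every earlier entry is below every later one, against indecomposability.
      no-cut : (D : Fin n → Set) → ∃ D → (∀ {i j} → D i → ¬ D j → i <ᶠ j × V i < V j) → ∀ i → D i
      no-cut D (i₀ , d₀) closed i = ¬¬-elim λ nd → go (least-by toℕ (λ i → ¬ D i) (i , nd))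
        where
        go : ¬ ∃ λ i → ¬ D i × (∀ j → ¬ D j → toℕ i ≤ toℕ j)
        go (Fin.zero , nd , min) with closed d₀ nd
        ... | () , _
        go (Fin.suc i , nd , min) =
          ind (take k xs) (drop k xs) (sym (take++drop≡id k xs)) (λ ())
              (¬Any-drop {xs} k (Fin.toℕ<n (Fin.suc i)))
              (All-take xs k λ p p<k → All-drop xs k λ q k≤q →
                 proj₂ (closed (¬¬-elim λ np → <⇒≱ p<k (min p np))
                               (λ dq → <⇒≱ (proj₁ (closed dq nd)) k≤q)))
          where
          k = toℕ (Fin.suc i)
          ¬Any-drop : ∀ {ys : List ℕ} k → k < length ys → drop k ys ≢ []
          ¬Any-drop {y ∷ ys} zero    _        ()
          ¬Any-drop {y ∷ ys} (suc k) (s≤s lt) e = ¬Any-drop k lt e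

      connected-key : (D : Fin n → Set) → ∃ D →
                      (∀ {i j} → D i → ¬ D j → ∀ b → key xs b i < key xs b j) → ∀ i → D i
      connected-key D d closed = no-cut D d λ di dj → closed di dj false , closed di dj true

      minimum : ∃ λ least-pt → ∀ i → V least-pt ≤ V i
      -- The predicate is a dummy, with 0 as its proof.
      minimum with least-by V (λ _ → ℕ) (Fin.zero , 0)
      ... | least-pt , _ , min = least-pt , λ i → min i 0

      least-pt = proj₁ minimum

      m≢0 : least-pt ≢ Fin.zero
      m≢0 eq with no-cut (_≡ Fin.zero) (Fin.zero , refl)
                   (λ { {j = Fin.zero} refl nd → contradiction refl nd
                      ; {j = Fin.suc j} refl nd → s≤s z≤n ,
                          ≤∧≢⇒< (subst (λ z → V z ≤ V (Fin.suc j)) eq (proj₂ minimum (Fin.suc j)))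
                                (λ e → nd (sym (V-inj e))) })
                   (Fin.suc Fin.zero)
      ... | ()

      V-m : ∀ {i} → i ≢ least-pt → V least-pt < V i
      V-m {i} i≢m = ≤∧≢⇒< (proj₂ minimum i) (λ e → i≢m (sym (V-inj e)))

      0<m : Fin.zero {n = suc (length xs₀)} <ᶠ least-pt
      0<m = n≢0⇒n>0 λ e → m≢0 (Fin.toℕ-injective e)

      lower-m : upper least-pt ≡ false
      lower-m with upper-or-lower least-pt
      ... | inj₂ l = l
      ... | inj₁ u = contradiction (upper⇒LRMax u Fin.zero 0<m) (≤⇒≯ (proj₂ minimum Fin.zero))

      m-first : ∀ {i} b → upper i ≡ false → key xs b least-pt ≤ key xs b i
      m-first {i} true  l = proj₂ minimum i
      m-first {i} false l = ≮⇒≥ λ lt → <⇒≱ (mono (trans l (sym lower-m)) lt) (proj₂ minimum i)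

      zero-first : ∀ {i} b → upper i ≡ true → key xs b Fin.zero ≤ key xs b i
      zero-first false u = z≤n
      zero-first {Fin.zero}  true u = ≤-refl
      zero-first {Fin.suc i} true u = <⇒≤ (upper⇒LRMax u Fin.zero (s≤s z≤n))

      K-bounded : ∀ b i → key xs b i ≤ sum xs + n
      K-bounded true  i = ≤-trans (lookup≤sum xs i) (m≤m+n _ n)
      K-bounded false i = ≤-trans (<⇒≤ (Fin.toℕ<n i)) (m≤n+m n _)

      -- The first entry and the smallest entry are adjacent. The path starts at the first entry if
      -- the smallest has a further neighbour `r`, and at the smallest entry otherwise; these are
      -- the two alternatives of `start`.
      shape : Σ (Shape (Fin n)) λ S → Shape.t S ≡ upper × Shape.K S ≡ key xs
      shape with em {∃ λ r → r ≢ Fin.zero × upper r ≡ true × r <ᶠ least-pt}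
      ... | yes (r , r≢ , ur , r<m) = record
        { t = upper ; K = key xs ; B = sum xs + n ; bounded = K-bounded
        ; points = allFin n ; listed = ∈-allFin ; K-inj = K-injective
        ; same = same-key ; cross = cross-key ; s = Fin.zero ; s′ = least-pt
        ; s-first = s-first
        ; s′-opp = trans lower-m (cong not (sym upper-zero))
        ; s′-first = λ b l → m-first b (trans l (cong not upper-zero))
        ; s-s′ = subst (λ b → key xs b least-pt < key xs b Fin.zero) (sym upper-zero) (V-m (m≢0 ∘ sym))
        ; start = inj₂ (r , r≢ , trans ur (sym upper-zero) ,
                        subst (λ b → key xs (not b) r < key xs (not b) least-pt) (sym upper-zero) r<m)
        ; connected = λ D d → connected-key D (Fin.zero , d) } , refl , refl
        where
        s-first : ∀ {x} → x ≢ Fin.zero → key xs (not (upper Fin.zero)) Fin.zero < key xs (not (upper Fin.zero)) x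
        s-first x≢ rewrite upper-zero = n≢0⇒n>0 λ e → x≢ (Fin.toℕ-injective e)
      ... | no none = record
        { t = upper ; K = key xs ; B = sum xs + n ; bounded = K-bounded
        ; points = allFin n ; listed = ∈-allFin ; K-inj = K-injective
        ; same = same-key ; cross = cross-key ; s = least-pt ; s′ = Fin.zero
        ; s-first = s-first
        ; s′-opp = trans upper-zero (cong not (sym lower-m))
        ; s′-first = λ b u → zero-first b (trans u (cong not lower-m))
        ; s-s′ = subst (λ b → key xs b Fin.zero < key xs b least-pt) (sym lower-m) 0<m
        ; start = inj₁ λ {x} u lt → ¬¬-elim λ x≢ → none (x , x≢ , trans u (cong not lower-m) ,
                     subst (λ b → key xs b x < key xs b least-pt) lower-m lt)
        ; connected = λ D d → connected-key D (least-pt , d) } , refl , refl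
        where
        s-first : ∀ {x} → x ≢ least-pt → key xs (not (upper least-pt)) least-pt < key xs (not (upper least-pt)) x
        s-first x≢ rewrite lower-m = V-m x≢

      Adj⇔Inv : ∀ {S} → Shape.t S ≡ upper → Shape.K S ≡ key xs →
                ∀ i j → Shape.Adj S i j ⇔ InvGraph xs i j
      Adj⇔Inv {S} refl refl i j = mk⇔ to from
        where
        to : Shape.Adj S i j → InvGraph xs i j
        to (o , u , d) with upper-or-lower i
        ... | inj₁ ui rewrite o | ui = inj₁ (u , d)
        ... | inj₂ li rewrite o | li = inj₂ (d , u)
        from : InvGraph xs i j → Shape.Adj S i j
        from (inj₁ (i<j , lt)) with Inv⇒types i<j lt
        ... | ui , lj rewrite ui | lj = refl , i<j , lt
        from (inj₂ (j<i , lt)) with Inv⇒types j<i lt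
        ... | uj , li rewrite uj | li = refl , lt , j<i

-- Direct sums

-- Same content as _≼_, as a record so that the two lists can be inferred.
record _⊴_ (xs ys : List ℕ) : Set where
  field
    fn   : Fin (length xs) → Fin (length ys)
    pos  : ∀ {i j} → i <ᶠ j → fn i <ᶠ fn j
    val  : ∀ {i j} → lookup xs i < lookup xs j → lookup ys (fn i) < lookup ys (fn j)
    val⁻ : ∀ {i j} → lookup ys (fn i) < lookup ys (fn j) → lookup xs i < lookup xs j

  pos⁻ : ∀ {i j} → fn i <ᶠ fn j → i <ᶠ j
  pos⁻ {i} {j} lt with Fin.<-cmp i j
  ... | tri< r _ _    = r
  ... | tri≈ _ refl _ = contradiction lt (<-irrefl refl)
  ... | tri> _ _ gt   = contradiction (pos gt) (<-asym lt)

  injective : ∀ {i j} → fn i ≡ fn j → i ≡ j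
  injective {i} {j} eq with Fin.<-cmp i j
  ... | tri< lt _ _ = contradiction (cong toℕ eq) (<⇒≢ (pos lt))
  ... | tri≈ _ e _  = e
  ... | tri> _ _ gt = contradiction (cong toℕ (sym eq)) (<⇒≢ (pos gt))

  inv : ∀ i j → InvGraph xs i j → InvGraph ys (fn i) (fn j)
  inv i j = Sum.map (λ (p , v) → pos p , val v) (λ (p , v) → pos p , val v)

  inv⁻ : ∀ i j → InvGraph ys (fn i) (fn j) → InvGraph xs i j
  inv⁻ i j = Sum.map (λ (p , v) → pos⁻ p , val⁻ v) (λ (p , v) → pos⁻ p , val⁻ v)

open _⊴_

≼⇒⊴ : ∀ {xs ys} → xs ≼ ys → xs ⊴ ys
≼⇒⊴ (f , p , v) = record
  { fn = f ; pos = p _ _ ; val = Equivalence.to (v _ _) ; val⁻ = Equivalence.from (v _ _) }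

⊴⇒≼ : ∀ {xs ys} → xs ⊴ ys → xs ≼ ys
⊴⇒≼ e = fn e , (λ _ _ → pos e) , λ _ _ → mk⇔ (val e) (val⁻ e)

⊴-intro : ∀ {xs ys} → Distinct xs → (f : Fin (length xs) → Fin (length ys)) →
          (∀ {i j} → i <ᶠ j → f i <ᶠ f j) →
          (∀ {i j} → lookup xs i < lookup xs j → lookup ys (f i) < lookup ys (f j)) → xs ⊴ ys
⊴-intro {xs} {ys} u f pos val = record { fn = f ; pos = pos ; val = val ; val⁻ = back }
  where
  back : ∀ {i j} → lookup ys (f i) < lookup ys (f j) → lookup xs i < lookup xs j
  back {i} {j} lt with <-cmp (lookup xs i) (lookup xs j)
  ... | tri< r _ _ = r
  ... | tri≈ _ e _ = contradiction (cong (lookup ys ∘ f) (u e)) (<⇒≢ lt)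
  ... | tri> _ _ r = contradiction (val r) (<-asym lt)

⊴-trans : ∀ {xs ys zs} → xs ⊴ ys → ys ⊴ zs → xs ⊴ zs
⊴-trans d e = record
  { fn = fn e ∘ fn d ; pos = pos e ∘ pos d ; val = val e ∘ val d ; val⁻ = val⁻ d ∘ val⁻ e }

Distinct-⊴ : ∀ {xs ys} → xs ⊴ ys → Distinct ys → Distinct xs
Distinct-⊴ {xs} {ys} e d {i} {j} eq with <-cmp (lookup ys (fn e i)) (lookup ys (fn e j))
... | tri< lt _ _ = contradiction eq (<⇒≢ (val⁻ e lt))
... | tri≈ _ e′ _ = injective e (d e′)
... | tri> _ _ gt = contradiction (sym eq) (<⇒≢ (val⁻ e gt))

Avoids-⊴ : ∀ {xs ys} → xs ⊴ ys → Avoids321 ys → Avoids321 xs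
Avoids-⊴ e av i<j j<k (p , q) = av (pos e i<j) (pos e j<k) (val e p , val e q)

ForkIn-⊴ : ∀ {xs ys k} → xs ⊴ ys → ForkIn (InvGraph xs) k → ForkIn (InvGraph ys) k
ForkIn-⊴ e (g , inj , fk) = fn e ∘ g , inj ∘ injective e , λ u v →
  mk⇔ (Equivalence.to (fk u v) ∘ inv⁻ e (g u) (g v)) (inv e (g u) (g v) ∘ Equivalence.from (fk u v))

inl : ∀ (xs ys : List ℕ) → Fin (length xs) → Fin (length (xs ++ ys))
inl (x ∷ xs) ys Fin.zero    = Fin.zero
inl (x ∷ xs) ys (Fin.suc i) = Fin.suc (inl xs ys i)

inr : ∀ (xs ys : List ℕ) → Fin (length ys) → Fin (length (xs ++ ys))
inr []       ys j = j
inr (x ∷ xs) ys j = Fin.suc (inr xs ys j)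

data Side (xs ys : List ℕ) : Fin (length (xs ++ ys)) → Set where
  left  : ∀ i → Side xs ys (inl xs ys i)
  right : ∀ j → Side xs ys (inr xs ys j)

side : ∀ xs ys i → Side xs ys i
side []       ys i           = right i
side (x ∷ xs) ys Fin.zero    = left Fin.zero
side (x ∷ xs) ys (Fin.suc i) with side xs ys i
... | left  j = left (Fin.suc j)
... | right j = right j

toℕ-inl : ∀ xs ys i → toℕ (inl xs ys i) ≡ toℕ i
toℕ-inl (x ∷ xs) ys Fin.zero    = refl
toℕ-inl (x ∷ xs) ys (Fin.suc i) = cong suc (toℕ-inl xs ys i)

toℕ-inr : ∀ xs ys j → toℕ (inr xs ys j) ≡ length xs + toℕ j
toℕ-inr []       ys j = refl
toℕ-inr (x ∷ xs) ys j = cong suc (toℕ-inr xs ys j)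

lookup-inl : ∀ xs ys i → lookup (xs ++ ys) (inl xs ys i) ≡ lookup xs i
lookup-inl (x ∷ xs) ys Fin.zero    = refl
lookup-inl (x ∷ xs) ys (Fin.suc i) = lookup-inl xs ys i

lookup-inr : ∀ xs ys j → lookup (xs ++ ys) (inr xs ys j) ≡ lookup ys j
lookup-inr []       ys j = refl
lookup-inr (x ∷ xs) ys j = lookup-inr xs ys j

inl<inr : ∀ xs ys i j → inl xs ys i <ᶠ inr xs ys j
inl<inr xs ys i j = subst₂ _<_ (sym (toℕ-inl xs ys i)) (sym (toℕ-inr xs ys j))
                           (<-≤-trans (Fin.toℕ<n i) (m≤m+n (length xs) (toℕ j)))

≪-lookup : ∀ {xs ys} → xs ≪ ys → ∀ i j → lookup xs i < lookup ys j
≪-lookup xs≪ys i j = All.lookup (All.lookup xs≪ys (∈-lookup i)) (∈-lookup j)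

⊴-inl : ∀ xs ys → xs ⊴ (xs ++ ys)
⊴-inl xs ys = record
  { fn   = inl xs ys
  ; pos  = λ {i} {j} → subst₂ _<_ (sym (toℕ-inl xs ys i)) (sym (toℕ-inl xs ys j))
  ; val  = λ {i} {j} → subst₂ _<_ (sym (lookup-inl xs ys i)) (sym (lookup-inl xs ys j))
  ; val⁻ = λ {i} {j} → subst₂ _<_ (lookup-inl xs ys i) (lookup-inl xs ys j) }

⊴-inr : ∀ xs ys → ys ⊴ (xs ++ ys)
⊴-inr xs ys = record
  { fn   = inr xs ys
  ; pos  = λ {i} {j} lt → subst₂ _<_ (sym (toℕ-inr xs ys i)) (sym (toℕ-inr xs ys j))
                                     (+-monoʳ-< (length xs) lt)
  ; val  = λ {i} {j} → subst₂ _<_ (sym (lookup-inr xs ys i)) (sym (lookup-inr xs ys j))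
  ; val⁻ = λ {i} {j} → subst₂ _<_ (lookup-inr xs ys i) (lookup-inr xs ys j) }

⊴-++ : ∀ {xs ys xs′ ys′} → xs ≪ ys → xs′ ≪ ys′ → xs ⊴ xs′ → ys ⊴ ys′ → (xs ++ ys) ⊴ (xs′ ++ ys′)
⊴-++ {xs} {ys} {xs′} {ys′} lo lo′ l r =
  record { fn = f ; pos = f-pos _ _ ; val = f-val _ _ ; val⁻ = f-val⁻ _ _ }
  where
  XS XS′ : List ℕ
  XS  = xs ++ ys
  XS′ = xs′ ++ ys′
  l₀ : xs ⊴ XS
  l₀ = ⊴-inl xs ys
  r₀ : ys ⊴ XS
  r₀ = ⊴-inr xs ys
  l′ : xs ⊴ XS′
  l′ = ⊴-trans l (⊴-inl xs′ ys′)
  r′ : ys ⊴ XS′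
  r′ = ⊴-trans r (⊴-inr xs′ ys′)
  place : ∀ {i} → Side xs ys i → Fin (length XS′)
  place (left i)  = fn l′ i
  place (right j) = fn r′ j
  f : Fin (length XS) → Fin (length XS′)
  f i = place (side xs ys i)
  low : ∀ i j → lookup XS (fn l₀ i) < lookup XS (fn r₀ j)
  low i j = subst₂ _<_ (sym (lookup-inl xs ys i)) (sym (lookup-inr xs ys j)) (≪-lookup lo i j)
  low′ : ∀ i j → lookup XS′ (fn l′ i) < lookup XS′ (fn r′ j)
  low′ i j = subst₂ _<_ (sym (lookup-inl xs′ ys′ (fn l i))) (sym (lookup-inr xs′ ys′ (fn r j)))
                        (≪-lookup lo′ (fn l i) (fn r j))
  f-pos : ∀ i j → i <ᶠ j → f i <ᶠ f j
  f-pos i j lt with side xs ys i | side xs ys j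
  ... | left i  | left j  = pos l′ (pos⁻ l₀ lt)
  ... | left i  | right j = inl<inr xs′ ys′ (fn l i) (fn r j)
  ... | right i | left j  = contradiction lt (<-asym (inl<inr xs ys j i))
  ... | right i | right j = pos r′ (pos⁻ r₀ lt)
  f-val : ∀ i j → lookup XS i < lookup XS j → lookup XS′ (f i) < lookup XS′ (f j)
  f-val i j lt with side xs ys i | side xs ys j
  ... | left i  | left j  = val l′ (val⁻ l₀ lt)
  ... | left i  | right j = low′ i j
  ... | right i | left j  = contradiction lt (<-asym (low j i))
  ... | right i | right j = val r′ (val⁻ r₀ lt)
  f-val⁻ : ∀ i j → lookup XS′ (f i) < lookup XS′ (f j) → lookup XS i < lookup XS j
  f-val⁻ i j lt with side xs ys i | side xs ys j
  ... | left i  | left j  = val l₀ (val⁻ l′ lt)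
  ... | left i  | right j = low i j
  ... | right i | left j  = contradiction lt (<-asym (low′ j i))
  ... | right i | right j = val r₀ (val⁻ r′ lt)

[]-⊴ : ∀ {ys} → [] ⊴ ys
[]-⊴ = record { fn = λ () ; pos = λ {} ; val = λ {} ; val⁻ = λ {} }

bounded-on : ∀ {A : Set} (f : A → ℕ) xs → ∃ λ b → ∀ {x} → x ∈ xs → f x ≤ b
bounded-on f []       = 0 , λ ()
bounded-on f (x ∷ xs) with bounded-on f xs
... | b , le = f x + b , λ { (here refl) → m≤m+n (f x) b
                           ; (there x∈)  → ≤-trans (le x∈) (m≤n+m b (f x)) }

-- Lists without long forks as direct sums of indecomposable blocks

module Blocks (em : ExcludedMiddle 0ℓ) (K₀ : ℕ) where
  open Classical em

  N : ℕ
  N = K₀ + 5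

  open Window em N

  abstract
    frame : ∀ {P} (S : Shape P) → (∀ k → K₀ ≤ k → ¬ ForkIn (Shape.Adj S) k) → Frame S
    frame S noFork with StairFork.fat-window em S noFork | bounded-on (Stair.c em S) (Shape.points S)
    ... | a , (x , cx) , thin | b , c≤b
      with greatest-by (Stair.c em S) b (λ _ → ℕ) (λ y _ → c≤b (Shape.listed S y)) (x , 0)
    ...   | top , _ , max = record
      { a = a ; e = Stair.c em S top ∸ a ; top = top ; top-c = sym top-c
      ; top-max = λ y → ≤-trans (max y 0) (≤-reflexive (sym top-c)) ; thin = thin }
      where
      top-c : a + (Stair.c em S top ∸ a) ≡ Stair.c em S top
      top-c = m+[n∸m]≡n (≤-trans (≤-reflexive (sym cx)) (max x 0))

  -- Distinct entries are asked for rather than a permutation, so that summands need no renumbering.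
  record Good (xs : List ℕ) : Set where
    field
      distinct : Distinct xs
      avoids   : Avoids321 xs
      no-fork  : ∀ k → K₀ ≤ k → ¬ ForkIn (InvGraph xs) k

  Good-⊴ : ∀ {xs ys} → xs ⊴ ys → Good ys → Good xs
  Good-⊴ e g = record
    { distinct = Distinct-⊴ e (Good.distinct g)
    ; avoids   = Avoids-⊴ e (Good.avoids g)
    ; no-fork  = λ k K₀≤k fk → Good.no-fork g k K₀≤k (ForkIn-⊴ e fk) }

  Block : Set
  Block = ∃ λ xs → Good xs × Indecomposable xs

  abstract
    drawing : ∀ {x y xs} → Good (x ∷ y ∷ xs) → Indecomposable (x ∷ y ∷ xs) →
              Σ (Shape (Fin (length (x ∷ y ∷ xs)))) λ S → Shape.K S ≡ key (x ∷ y ∷ xs) × Frame S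
    drawing {x} {y} {xs} g ind with shape em x y xs (Good.distinct g) (Good.avoids g) ind
    ... | S , t≡ , K≡ = S , K≡ , frame S λ k K₀≤k (h , inj , fk) → Good.no-fork g k K₀≤k
      (h , inj , λ u v → let eqv = Adj⇔Inv em x y xs (Good.distinct g) (Good.avoids g) ind {S} t≡ K≡ (h u) (h v) in
        mk⇔ (Equivalence.to (fk u v) ∘ Equivalence.from eqv)
            (Equivalence.to eqv ∘ Equivalence.from (fk u v)))

  -- The type of `pt a`, or one of two tags for blocks of length 0 and 1, which have no shape; then
  -- the number of cells before the window, the distance from its first cell to the last cell of
  -- all, and the word.
  Profile : Set
  Profile = Fin 4 × ℕ × ℕ × List (Fin (suc N))

  _⊑_ : Profile → Profile → Set
  _⊑_ = _≡_ ⊗ _≤_ ⊗ _≤_ ⊗ Emb _≡_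

  abstract
    ⊑-wqo : Wqo _⊑_
    ⊑-wqo = ⊗-wqo {R = _≡_} {S = _≤_ ⊗ _≤_ ⊗ Emb _≡_} ≡-wqo trans
           (⊗-wqo {R = _≤_} {S = _≤_ ⊗ Emb _≡_} ≤-wqo ≤-trans
           (⊗-wqo {R = _≤_} {S = Emb _≡_} ≤-wqo ≤-trans
           (Higman.Emb-wqo {R = _≡_} ≡-wqo trans)))

  bool : Bool → Fin 4
  bool false = Fin.zero
  bool true  = Fin.suc Fin.zero

  profile : Block → Profile
  profile ([] , _)               = Fin.suc (Fin.suc Fin.zero) , 0 , 0 , []
  profile (x ∷ [] , _)           = Fin.suc (Fin.suc (Fin.suc Fin.zero)) , 0 , 0 , []
  profile (x ∷ y ∷ xs , g , ind) with drawing g ind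
  ... | S , _ , F = bool (Frame.type F) , Frame.a F , Frame.e F , Frame.word F

  bool-inj : ∀ {b b′} → bool b ≡ bool b′ → b ≡ b′
  bool-inj {false} {false} _ = refl
  bool-inj {true}  {true}  _ = refl

  bool-small : ∀ {b i} → bool b ≢ Fin.suc (Fin.suc i)
  bool-small {false} ()
  bool-small {true}  ()

  _⊴ᵇ_ : Block → Block → Set
  b ⊴ᵇ b′ = proj₁ b ⊴ proj₁ b′

  profile-⊴ : ∀ b b′ → profile b ⊑ profile b′ → b ⊴ᵇ b′
  profile-⊴ ([] , _) _ _ = []-⊴
  profile-⊴ (x ∷ [] , _) (y ∷ [] , _) _ = record
    { fn = id ; pos = id ; val = λ { {Fin.zero} {Fin.zero} → ⊥-elim ∘ <-irrefl refl }
    ; val⁻ = λ { {Fin.zero} {Fin.zero} → ⊥-elim ∘ <-irrefl refl } }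
  profile-⊴ (x ∷ [] , _) ([] , _) (() , _)
  profile-⊴ (x ∷ [] , _) (y ∷ z ∷ ys , g , ind) (eq , _) with drawing g ind
  ... | _ = contradiction (sym eq) bool-small
  profile-⊴ (x ∷ w ∷ xs , g , ind) ([] , _) (eq , _) with drawing g ind
  ... | _ = contradiction eq bool-small
  profile-⊴ (x ∷ w ∷ xs , g , ind) (y ∷ [] , _) (eq , _) with drawing g ind
  ... | _ = contradiction eq bool-small
  profile-⊴ (x ∷ w ∷ xs , g , ind) (y ∷ z ∷ ys , g′ , ind′) (eq , a≤ , e≤ , emb)
    with drawing g ind | drawing g′ ind′
  ... | S , K≡ , F | S′ , K≡′ , F′ with embed F F′ (bool-inj eq) a≤ e≤ emb
  ...   | f , pres rewrite K≡ | K≡′ =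
    ⊴-intro (Good.distinct g) f (pres false) (pres true)

  Block-wqo : Wqo _⊴ᵇ_
  Block-wqo f =
    let i , j , i<j , le = ⊑-wqo (profile ∘ f) in i , j , i<j , profile-⊴ (f i) (f j) le

  data DirectSum : List ℕ → List Block → Set where
    []   : DirectSum [] []
    _⊕_⟨_⟩ : ∀ b {xs bs} → DirectSum xs bs → proj₁ b ≪ xs → DirectSum (proj₁ b ++ xs) (b ∷ bs)

  DirectSum-++ : ∀ {xs ys bs cs} → DirectSum xs bs → DirectSum ys cs → xs ≪ ys → DirectSum (xs ++ ys) (bs ++ cs)
  DirectSum-++ [] t _ = t
  DirectSum-++ {ys = ys} (_⊕_⟨_⟩ b {xs} s b≪) t xs≪ys =
    subst (λ zs → DirectSum zs _) (sym (++-assoc (proj₁ b) xs ys))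
      (b ⊕ DirectSum-++ s t (All.++⁻ʳ (proj₁ b) xs≪ys)
         ⟨ All.zipWith (λ (p , q) → All.++⁺ p q) (b≪ , All.++⁻ˡ (proj₁ b) xs≪ys) ⟩)

  abstract
    decompose : ∀ xs → Good xs → ∃ λ bs → DirectSum xs bs
    decompose xs g =
      <-rec (λ n → ∀ xs → length xs ≡ n → Good xs → ∃ λ bs → DirectSum xs bs) step (length xs) xs refl g
      where
      step : ∀ n → (∀ {m} → m < n → ∀ xs → length xs ≡ m → Good xs → ∃ λ bs → DirectSum xs bs) →
             ∀ xs → length xs ≡ n → Good xs → ∃ λ bs → DirectSum xs bs
      step n rec xs refl g
        with em {∃₂ λ ys zs → xs ≡ ys ++ zs × ys ≢ [] × zs ≢ [] × ys ≪ zs}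
      ... | yes (ys , zs , refl , ys≢ , zs≢ , lo) =
        let bs , s = rec (subst (length ys <_) (sym (length-++ ys)) (m<m+n _ (nonempty zs≢))) ys refl
                         (Good-⊴ (⊴-inl ys zs) g)
            cs , t = rec (subst (length zs <_) (sym (length-++ ys)) (m<n+m _ (nonempty ys≢))) zs refl
                         (Good-⊴ (⊴-inr ys zs) g)
        in bs ++ cs , DirectSum-++ s t lo
        where
        nonempty : ∀ {ws : List ℕ} → ws ≢ [] → 0 < length ws
        nonempty {[]}    ne = contradiction refl ne
        nonempty {_ ∷ _} ne = s≤s z≤n
      -- This includes the empty list, which is vacuously indecomposable.
      ... | no none = b ∷ [] , subst (λ ys → DirectSum ys (b ∷ [])) (++-identityʳ xs)
                                     (b ⊕ [] ⟨ All.universal (λ _ → []) xs ⟩)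
        where
        b : Block
        b = xs , g , λ ys zs eq p q lo → none (ys , zs , eq , p , q , lo)

  DirectSum-⊴ : ∀ {xs ys bs cs} → DirectSum xs bs → DirectSum ys cs → Emb _⊴ᵇ_ bs cs → xs ⊴ ys
  DirectSum-⊴ [] _ _ = []-⊴
  DirectSum-⊴ s (c ⊕ t ⟨ _ ⟩) (skip e) = ⊴-trans (DirectSum-⊴ s t e) (⊴-inr (proj₁ c) _)
  DirectSum-⊴ (b ⊕ s ⟨ lo ⟩) (c ⊕ t ⟨ lo′ ⟩) (keep le e) = ⊴-++ lo lo′ le (DirectSum-⊴ s t e)

  Good-wqo : (f : ℕ → ∃ Good) → ∃₂ λ i j → i < j × proj₁ (f i) ⊴ proj₁ (f j)
  Good-wqo f =
    let i , j , i<j , e = Higman.Emb-wqo {R = _⊴ᵇ_} Block-wqo ⊴-trans blocks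
    in i , j , i<j , DirectSum-⊴ (sums i) (sums j) e
    where
    blocks : ℕ → List Block
    blocks i = proj₁ (decompose (proj₁ (f i)) (proj₂ (f i)))
    sums : ∀ i → DirectSum (proj₁ (f i)) (blocks i)
    sums i = proj₂ (decompose (proj₁ (f i)) (proj₂ (f i)))

-- Standardisation

module _ {A : Set} {P Q : A → Set} (P? : Decidable P) (Q? : Decidable Q) (P⇒Q : ∀ {x} → P x → Q x) where

  filter-mono-≤ : ∀ xs → length (filter P? xs) ≤ length (filter Q? xs)
  filter-mono-≤ []       = z≤n
  filter-mono-≤ (x ∷ xs) with P? x | Q? x
  ... | yes p | yes q = s≤s (filter-mono-≤ xs)
  ... | yes p | no nq = contradiction (P⇒Q p) nq
  ... | no np | yes q = m≤n⇒m≤1+n (filter-mono-≤ xs)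
  ... | no np | no nq = filter-mono-≤ xs

  filter-mono-< : ∀ {x xs} → x ∈ xs → ¬ P x → Q x → length (filter P? xs) < length (filter Q? xs)
  filter-mono-< {x} {y ∷ xs} x∈ np q with P? y | Q? y
  filter-mono-< (here refl) np q | yes p | _     = contradiction p np
  filter-mono-< (here refl) np q | _     | no nq = contradiction q nq
  filter-mono-< {xs = y ∷ xs} (here refl) np q | no _ | yes _ = s≤s (filter-mono-≤ xs)
  filter-mono-< (there x∈)  np q | yes p | yes _ = s≤s (filter-mono-< x∈ np q)
  filter-mono-< (there x∈)  np q | yes p | no nq = contradiction (P⇒Q p) nq
  filter-mono-< (there x∈)  np q | no _  | yes _ = m<n⇒m<1+n (filter-mono-< x∈ np q)
  filter-mono-< (there x∈)  np q | no _  | no _  = filter-mono-< x∈ np q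

module _ {m : ℕ} (h : Fin m → ℕ) where

  smaller : Fin m → ℕ
  smaller i = length (filter (λ j → h j <? h i) (allFin m))

  smaller< : ∀ i → smaller i < m
  smaller< i = subst (smaller i <_) (length-tabulate id)
    (filter-notAll (λ j → h j <? h i) (allFin m) (here-at (∈-allFin i)))
    where
    here-at : ∀ {xs} → i ∈ xs → Any (λ j → ¬ h j < h i) xs
    here-at (here refl) = here (<-irrefl refl)
    here-at (there i∈)  = there (here-at i∈)

  abstract
    rank : Fin m → Fin m
    rank i = fromℕ< (smaller< i)

    rank-mono : ∀ {i j} → h i < h j → rank i <ᶠ rank j
    rank-mono {i} {j} lt = subst₂ _<_ (sym (Fin.toℕ-fromℕ< (smaller< i))) (sym (Fin.toℕ-fromℕ< (smaller< j)))
      (filter-mono-< (λ k → h k <? h i) (λ k → h k <? h j) (λ k<i → <-trans k<i lt)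
                     (∈-allFin i) (<-irrefl refl) lt)

    module _ (h-inj : ∀ {i j} → h i ≡ h j → i ≡ j) where

      rank-mono⁻ : ∀ {i j} → rank i <ᶠ rank j → h i < h j
      rank-mono⁻ {i} {j} lt with <-cmp (h i) (h j)
      ... | tri< r _ _ = r
      ... | tri≈ _ e _ = contradiction lt (<-irrefl (cong (toℕ ∘ rank) (h-inj e)))
      ... | tri> _ _ r = contradiction lt (<-asym (rank-mono r))

      rank-injective : ∀ {i j} → rank i ≡ rank j → i ≡ j
      rank-injective {i} {j} eq with <-cmp (h i) (h j)
      ... | tri< r _ _ = contradiction (cong toℕ eq) (<⇒≢ (rank-mono r))
      ... | tri≈ _ e _ = h-inj e
      ... | tri> _ _ r = contradiction (cong toℕ (sym eq)) (<⇒≢ (rank-mono r))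

abstract
  injective⇒surjective : ∀ {m} (f : Fin m → Fin m) → (∀ {i j} → f i ≡ f j → i ≡ j) → ∀ y → ∃ λ x → f x ≡ y
  injective⇒surjective {suc m} f inj y with Fin.any? (λ x → f x Fin.≟ y)
  ... | yes p = p
  ... | no  n = contradiction (λ {i} {j} eq → inj (Fin.punchOut-injective (y≢ i) (y≢ j) eq))
                              (Fin.<⇒notInjective {f = λ x → punchOut (y≢ x)} (n<1+n m))
    where
    y≢ : ∀ x → y ≢ f x
    y≢ x e = n (x , sym e)

-- The points chosen by `g` come in arbitrary order, like the vertices of a fork. Ranking by
-- position sorts them (`ρ⁻` undoes this rank), ranking by value then gives the one-line notation,
-- and `ι` recalls which chosen point stands at each place.
standardise : ∀ {xs m} → Distinct xs → (g : Fin m → Fin (length xs)) → (∀ {i j} → g i ≡ g j → i ≡ j) →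
              ∃ λ σ → IsPerm σ × length σ ≡ m × Σ (σ ⊴ xs) λ e →
              ∃ λ (ι : Fin (length σ) → Fin m) → Bijective _≡_ _≡_ ι × (∀ i → fn e i ≡ g (ι i))
standardise {xs} {m} d g g-inj = σ , (bounded , unique) , length-σ , e , ι , (ι-inj , ι-surj) , λ _ → refl
  where
  h : Fin m → ℕ
  h = toℕ ∘ g
  h-inj : ∀ {i j} → h i ≡ h j → i ≡ j
  h-inj = g-inj ∘ Fin.toℕ-injective
  unrank : ∀ i → ∃ λ j → rank h j ≡ i
  unrank = injective⇒surjective (rank h) (rank-injective h h-inj)
  ρ⁻ : Fin m → Fin m
  ρ⁻ = proj₁ ∘ unrank
  ρ⁻-inj : ∀ {i j} → ρ⁻ i ≡ ρ⁻ j → i ≡ j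
  ρ⁻-inj {i} {j} eq = trans (sym (proj₂ (unrank i))) (trans (cong (rank h) eq) (proj₂ (unrank j)))
  g′ : Fin m → Fin (length xs)
  g′ = g ∘ ρ⁻
  g′-mono : ∀ {i j} → i <ᶠ j → g′ i <ᶠ g′ j
  g′-mono {i} {j} lt = rank-mono⁻ h h-inj
    (subst₂ _<ᶠ_ (sym (proj₂ (unrank i))) (sym (proj₂ (unrank j))) lt)
  w : Fin m → ℕ
  w = lookup xs ∘ g′
  w-inj : ∀ {i j} → w i ≡ w j → i ≡ j
  w-inj = ρ⁻-inj ∘ g-inj ∘ d
  τ : Fin m → Fin m
  τ = rank w
  σ : List ℕ
  σ = tabulate (toℕ ∘ τ)
  length-σ : length σ ≡ m
  length-σ = length-tabulate (toℕ ∘ τ)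
  bounded : All (_< length σ) σ
  bounded = All.tabulate⁺ λ i → subst (toℕ (τ i) <_) (sym length-σ) (Fin.toℕ<n (τ i))
  unique : Unique σ
  unique = Unique.tabulate⁺ (rank-injective w w-inj ∘ Fin.toℕ-injective)
  κ : Fin (length σ) → Fin m
  κ = Fin.cast length-σ
  toℕ-κ : ∀ i → toℕ (κ i) ≡ toℕ i
  toℕ-κ = Fin.toℕ-cast length-σ
  κ-inj : ∀ {i j} → κ i ≡ κ j → i ≡ j
  κ-inj {i} {j} eq = Fin.toℕ-injective (trans (sym (toℕ-κ i)) (trans (cong toℕ eq) (toℕ-κ j)))
  lookup-σ : ∀ i → lookup σ i ≡ toℕ (τ (κ i))
  lookup-σ i = trans
    (cong (lookup σ) (Fin.toℕ-injective (sym (trans (Fin.toℕ-cast (sym length-σ) (κ i)) (toℕ-κ i)))))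
    (lookup-tabulate (toℕ ∘ τ) (κ i))
  e : σ ⊴ xs
  e = ⊴-intro (lookup-injective unique) (g′ ∘ κ)
    (λ {i} {j} lt → g′-mono (subst₂ _<_ (sym (toℕ-κ i)) (sym (toℕ-κ j)) lt))
    (λ {i} {j} lt → rank-mono⁻ w w-inj (subst₂ _<_ (lookup-σ i) (lookup-σ j) lt))
  ι : Fin (length σ) → Fin m
  ι = ρ⁻ ∘ κ
  ι-inj : ∀ {i j} → ι i ≡ ι j → i ≡ j
  ι-inj = κ-inj ∘ ρ⁻-inj
  ι-surj : ∀ y → ∃ λ x → ∀ {z} → z ≡ x → ι z ≡ y
  ι-surj y = Fin.cast (sym length-σ) (rank h y) , λ { refl → rank-injective h h-inj
    (trans (proj₂ (unrank _)) (Fin.toℕ-injective (trans (toℕ-κ _) (Fin.toℕ-cast (sym length-σ) _)))) }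

fork-perm : ∀ {xs k} → Distinct xs → 2 ≤ k → ForkIn (InvGraph xs) k →
            ∃ λ σ → InU σ × σ ≼ xs × length σ ≡ k + 4
fork-perm {xs} {k} d 2≤k (g , g-inj , fk) with standardise {xs} d g g-inj
... | σ , perm , len , e , ι , bij , fn≡ = σ , (perm , k , 2≤k , ι , bij , iso) , ⊴⇒≼ e , len
  where
  iso : ∀ u v → InvGraph σ u v ⇔ Fork k (ι u) (ι v)
  iso u v = mk⇔
    (λ i → Equivalence.to (fk (ι u) (ι v)) (subst₂ (InvGraph xs) (fn≡ u) (fn≡ v) (inv e u v i)))
    (λ f → inv⁻ e u v (subst₂ (InvGraph xs) (sym (fn≡ u)) (sym (fn≡ v)) (Equivalence.from (fk (ι u) (ι v)) f)))

-- Serves to show that short permutations are finitely many: `words n n` contains all those of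
-- length at most `n`.
words : ℕ → ℕ → List (List ℕ)
words n zero    = [] ∷ []
words n (suc l) = [] ∷ cartesianProductWith _∷_ (upTo n) (words n l)

∈-words : ∀ {n l xs} → All (_< n) xs → length xs ≤ l → xs ∈ words n l
∈-words {l = zero}  []        _         = here refl
∈-words {l = suc l} []        _         = here refl
∈-words {l = suc l} (x< ∷ xs<) (s≤s le) = there (∈-cartesianProductWith⁺ _∷_ (∈-upTo⁺ x<) (∈-words xs< le))

-- Incomparability of forks

Edge : ℕ → ℕ → ℕ → Set
Edge k u v = ForkEdge k u v ⊎ ForkEdge k v u

-- The retraction of a fork onto its path, folding each leaf onto the vertex it hangs from. Adjacent
-- vertices go to equal or consecutive ones, so differences of locations are lower bounds for
-- distances.
location : ℕ → ℕ → ℕ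
location m u with u <? m | u <? 2 + m
... | yes _ | _     = u
... | no  _ | yes _ = 0
... | no  _ | no  _ = pred m

location-path : ∀ {m u} → u < m → location m u ≡ u
location-path {m} {u} u<m with u <? m
... | yes _  = refl
... | no u≮m = contradiction u<m u≮m

location-left : ∀ {m u} → m ≤ u → u < 2 + m → location m u ≡ 0
location-left {m} {u} m≤u u< with u <? m | u <? 2 + m
... | yes u<m | _     = contradiction u<m (≤⇒≯ m≤u)
... | no _    | yes _ = refl
... | no _    | no u≮ = contradiction u< u≮

location-right : ∀ {m u} → 2 + m ≤ u → location m u ≡ pred m
location-right {m} {u} ≤u with u <? m | u <? 2 + m
... | yes u<m | _      = contradiction (≤-trans (m≤n+m m 2) ≤u) (<⇒≱ u<m)
... | no _    | yes u< = contradiction u< (≤⇒≯ ≤u)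
... | no _    | no _   = refl

pred< : ∀ {m} → 2 ≤ m → pred m < m
pred< (s≤s _) = n<1+n _

location-edge : ∀ {m u v} → 2 ≤ m → ForkEdge m u v →
                location m u ≤ suc (location m v) × location m v ≤ suc (location m u)
location-edge {m} 2≤m (path {u} lt)
  rewrite location-path (<-trans (n<1+n u) lt) | location-path lt = ≤-trans (n≤1+n u) (n≤1+n _) , ≤-refl
location-edge {m} 2≤m leftA
  rewrite location-path {m} (≤-trans (s≤s z≤n) 2≤m) | location-left {m} ≤-refl (m<n+m m (s≤s (z≤n {1}))) = z≤n , z≤n
location-edge {m} 2≤m leftB
  rewrite location-path {m} (≤-trans (s≤s z≤n) 2≤m) | location-left {m} (n≤1+n m) ≤-refl = z≤n , z≤n
location-edge {m} 2≤m rightA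
  rewrite location-path {m} (pred< 2≤m) | location-right {m} (≤-refl {2 + m}) = n≤1+n _ , n≤1+n _
location-edge {m} 2≤m rightB
  rewrite location-path {m} (pred< 2≤m) | location-right {m} (n≤1+n (2 + m)) = n≤1+n _ , n≤1+n _

-- Only the ends of the path have degree three or more, so an injective map that preserves edges
-- must send ends to ends.
two-neighbours : ∀ {m v} → 2 ≤ m → v ≢ 0 → v ≢ pred m →
                 ∃₂ λ a b → ∀ w → Edge m v w → w ≡ a ⊎ w ≡ b
two-neighbours {m} {v} 2≤m v≢0 v≢last with v <? m
... | yes v<m = pred v , suc v , nbr
  where
  nbr : ∀ w → Edge m v w → w ≡ pred v ⊎ w ≡ suc v
  nbr w (inj₁ (path _)) = inj₂ refl
  nbr w (inj₁ leftA)    = contradiction refl v≢0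
  nbr w (inj₁ leftB)    = contradiction refl v≢0
  nbr w (inj₁ rightA)   = contradiction refl v≢last
  nbr w (inj₁ rightB)   = contradiction refl v≢last
  nbr w (inj₂ (path _)) = inj₁ refl
  nbr w (inj₂ leftA)    = contradiction v<m (<-irrefl refl)
  nbr w (inj₂ leftB)    = contradiction v<m (m+n≮n 1 m)
  nbr w (inj₂ rightA)   = contradiction v<m (m+n≮n 2 m)
  nbr w (inj₂ rightB)   = contradiction v<m (m+n≮n 3 m)
-- A leaf has a single neighbour, which is named twice.
... | no v≮m = location m v , location m v , λ w e → inj₁ (nbr w e)
  where
  nbr : ∀ w → Edge m v w → w ≡ location m v
  nbr w (inj₁ (path lt)) = contradiction (<-trans (n<1+n v) lt) v≮m
  nbr w (inj₁ leftA)     = contradiction refl v≢0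
  nbr w (inj₁ leftB)     = contradiction refl v≢0
  nbr w (inj₁ rightA)    = contradiction refl v≢last
  nbr w (inj₁ rightB)    = contradiction refl v≢last
  nbr w (inj₂ (path lt)) = contradiction lt v≮m
  nbr w (inj₂ leftA)     = sym (location-left ≤-refl (m<n+m m (s≤s z≤n)))
  nbr w (inj₂ leftB)     = sym (location-left (n≤1+n m) ≤-refl)
  nbr w (inj₂ rightA)    = sym (location-right {m} (≤-refl {2 + m}))
  nbr w (inj₂ rightB)    = sym (location-right {m} (n≤1+n (2 + m)))

pick-two : ∀ {a b x y z : ℕ} → x ≡ a ⊎ x ≡ b → y ≡ a ⊎ y ≡ b → z ≡ a ⊎ z ≡ b →
           x ≢ y → x ≢ z → y ≢ z → ⊥
pick-two (inj₁ refl) (inj₁ refl) _           x≢y _   _   = x≢y refl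
pick-two (inj₁ refl) (inj₂ refl) (inj₁ refl) _   x≢z _   = x≢z refl
pick-two (inj₁ refl) (inj₂ refl) (inj₂ refl) _   _   y≢z = y≢z refl
pick-two (inj₂ refl) (inj₂ refl) _           x≢y _   _   = x≢y refl
pick-two (inj₂ refl) (inj₁ refl) (inj₂ refl) _   x≢z _   = x≢z refl
pick-two (inj₂ refl) (inj₁ refl) (inj₁ refl) _   _   y≢z = y≢z refl

-- The ends of the path go to ends, as no other vertex has three neighbours, and their distance does
-- not grow.
fork-incomparable : ∀ {k m} → 2 ≤ k → k < m → (H : ℕ → ℕ) →
  (∀ {u v} → u < 4 + k → v < 4 + k → H u ≡ H v → u ≡ v) →
  (∀ {u v} → u < 4 + k → v < 4 + k → ForkEdge k u v → Edge m (H u) (H v)) → ⊥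
fork-incomparable {k@(suc (suc k₂))} {m} 2≤k k<m H inj edge = ends
  (end 0 1 k (suc k) p0 p1 pA pB
       (inj₁ (path 2≤k)) (inj₁ leftA) (inj₁ leftB) (λ ()) (λ ()) m≢1+m)
  (end (suc k₂) k₂ (2 + k) (3 + k) pL pM pC pD
       (inj₂ (path ≤-refl)) (inj₁ rightA) (inj₁ rightB) k₂≢ k₂≢′ m≢1+m)
  where
  2≤m : 2 ≤ m
  2≤m = ≤-trans 2≤k (<⇒≤ k<m)
  k₂≢ : k₂ ≢ 4 + k₂
  k₂≢ = m≢1+m+n k₂ ∘ λ e → trans e (cong suc (+-comm 3 k₂))
  k₂≢′ : k₂ ≢ 5 + k₂
  k₂≢′ = m≢1+m+n k₂ ∘ λ e → trans e (cong suc (+-comm 4 k₂))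
  p : ∀ i → i < 6 → i + k₂ < 4 + k
  p i lt = +-monoˡ-< k₂ lt
  p0 : 0 < 4 + k
  p0 = s≤s z≤n
  p1 : 1 < 4 + k
  p1 = s≤s (s≤s z≤n)
  pM = p 0 (s≤s z≤n)
  pL = p 1 (s≤s (s≤s z≤n))
  pA = p 2 (s≤s (s≤s (s≤s z≤n)))
  pB = p 3 (s≤s (s≤s (s≤s (s≤s z≤n))))
  pC = p 4 (s≤s (s≤s (s≤s (s≤s (s≤s z≤n)))))
  pD = p 5 ≤-refl
  image : ∀ {u v} → u < 4 + k → v < 4 + k → Edge k u v → Edge m (H u) (H v)
  image u< v< (inj₁ e) = edge u< v< e
  image u< v< (inj₂ e) = Sum.swap (edge v< u< e)
  end : ∀ v x y z → v < 4 + k → x < 4 + k → y < 4 + k → z < 4 + k →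
        Edge k v x → Edge k v y → Edge k v z → x ≢ y → x ≢ z → y ≢ z → H v ≡ 0 ⊎ H v ≡ pred m
  end v x y z v< x< y< z< ex ey ez x≢y x≢z y≢z with H v ≟ 0 | H v ≟ pred m
  ... | yes e | _     = inj₁ e
  ... | no _  | yes e = inj₂ e
  ... | no n  | no n′ with two-neighbours 2≤m n n′
  ...   | a , b , only = ⊥-elim (pick-two
    (only _ (image v< x< ex)) (only _ (image v< y< ey)) (only _ (image v< z< ez))
    (x≢y ∘ inj x< y<) (x≢z ∘ inj x< z<) (y≢z ∘ inj y< z<))
  loc : ℕ → ℕ
  loc u = location m (H u)
  step : ∀ {u} → suc u < k → loc u ≤ suc (loc (suc u)) × loc (suc u) ≤ suc (loc u)
  step {u} lt with edge (≤-trans (<-trans (n<1+n u) lt) (m≤n+m k 4)) (≤-trans lt (m≤n+m k 4)) (path lt)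
  ... | inj₁ e = location-edge 2≤m e
  ... | inj₂ e = swap (location-edge 2≤m e)
  walk : ∀ u → u < k → loc u ≤ u + loc 0 × loc 0 ≤ u + loc u
  walk zero    lt = ≤-refl , ≤-refl
  walk (suc u) lt with walk u (<-trans (n<1+n u) lt) | step lt
  ... | up , down | back , fwd = ≤-trans fwd (s≤s up) ,
        ≤-trans down (≤-trans (+-monoʳ-≤ u back) (≤-reflexive (+-suc u _)))
  loc-0 : ∀ {u} → H u ≡ 0 → loc u ≡ 0
  loc-0 e = trans (cong (location m) e) (location-path (≤-trans (s≤s z≤n) 2≤m))
  loc-last : ∀ {u} → H u ≡ pred m → loc u ≡ pred m
  loc-last e = trans (cong (location m) e) (location-path (pred< 2≤m))
  too-short : ¬ pred m ≤ suc k₂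
  too-short le = <⇒≱ (<-≤-trans k<m (≤-reflexive (sym (suc-pred m ⦃ >-nonZero (≤-trans (s≤s z≤n) 2≤m) ⦄)))) (s≤s le)
  ends : H 0 ≡ 0 ⊎ H 0 ≡ pred m → H (suc k₂) ≡ 0 ⊎ H (suc k₂) ≡ pred m → ⊥
  ends (inj₁ e) (inj₁ e′) = 0≢1+n (inj p0 pL (trans e (sym e′)))
  ends (inj₂ e) (inj₂ e′) = 0≢1+n (inj p0 pL (trans e (sym e′)))
  ends (inj₁ e) (inj₂ e′) with walk (suc k₂) ≤-refl
  ... | up , _ = too-short
    (≤-trans (subst₂ (λ a b → a ≤ suc k₂ + b) (loc-last e′) (loc-0 e) up) (≤-reflexive (+-identityʳ _)))
  ends (inj₂ e) (inj₁ e′) with walk (suc k₂) ≤-refl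
  ... | _ , down = too-short
    (≤-trans (subst₂ (λ a b → a ≤ suc k₂ + b) (loc-last e) (loc-0 e′) down) (≤-reflexive (+-identityʳ _)))
fork-incomparable {suc zero} (s≤s ()) _ _ _ _

⊴-length : ∀ {xs ys} → xs ⊴ ys → length xs ≤ length ys
⊴-length e = Fin.injective⇒≤ (injective e)

321-⊴ : ∀ {xs} {i j k : Fin (length xs)} → i <ᶠ j → j <ᶠ k →
        lookup xs k < lookup xs j → lookup xs j < lookup xs i → p321 ⊴ xs
321-⊴ {xs} {i} {j} {k} i<j j<k kj ji = ⊴-intro distinct f (pos′ _ _) (val′ _ _)
  where
  f : Fin 3 → Fin (length xs)
  f Fin.zero                    = i
  f (Fin.suc Fin.zero)          = j
  f (Fin.suc (Fin.suc Fin.zero)) = k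
  distinct : Distinct p321
  distinct = lookup-injective (((λ ()) ∷ (λ ()) ∷ []) ∷ ((λ ()) ∷ []) ∷ [] ∷ [])
  pos′ : ∀ x y → x <ᶠ y → f x <ᶠ f y
  pos′ Fin.zero           (Fin.suc Fin.zero)           _ = i<j
  pos′ Fin.zero           (Fin.suc (Fin.suc Fin.zero)) _ = <-trans i<j j<k
  pos′ (Fin.suc Fin.zero) (Fin.suc (Fin.suc Fin.zero)) _ = j<k
  pos′ (Fin.suc Fin.zero) (Fin.suc Fin.zero)           (s≤s ())
  pos′ (Fin.suc (Fin.suc Fin.zero)) (Fin.suc Fin.zero) (s≤s ())
  pos′ (Fin.suc (Fin.suc Fin.zero)) (Fin.suc (Fin.suc Fin.zero)) (s≤s (s≤s ()))
  val′ : ∀ x y → lookup p321 x < lookup p321 y → lookup xs (f x) < lookup xs (f y)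
  val′ (Fin.suc Fin.zero)           Fin.zero           _ = ji
  val′ (Fin.suc (Fin.suc Fin.zero)) Fin.zero           _ = <-trans kj ji
  val′ (Fin.suc (Fin.suc Fin.zero)) (Fin.suc Fin.zero) _ = kj
  val′ Fin.zero           Fin.zero                     (s≤s (s≤s ()))
  val′ Fin.zero           (Fin.suc Fin.zero)           (s≤s ())
  val′ (Fin.suc Fin.zero) (Fin.suc Fin.zero)           (s≤s ())
  val′ Fin.zero                     (Fin.suc (Fin.suc Fin.zero)) ()
  val′ (Fin.suc Fin.zero)           (Fin.suc (Fin.suc Fin.zero)) ()
  val′ (Fin.suc (Fin.suc Fin.zero)) (Fin.suc (Fin.suc Fin.zero)) ()

InU-incomparable : ∀ {σ π} → InU σ → InU π → length σ < length π → ¬ σ ⊴ π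
InU-incomparable {σ} {π} (_ , k , 2≤k , φ , (φ-inj , φ-surj) , φ-iso)
                 (_ , m , 2≤m , ψ , (ψ-inj , ψ-surj) , ψ-iso) σ<π e =
  fork-incomparable 2≤k k<m H H-inj H-edge
  where
  φ⁻ : Fin (k + 4) → Fin (length σ)
  φ⁻ u = proj₁ (φ-surj u)
  φφ⁻ : ∀ u → φ (φ⁻ u) ≡ u
  φφ⁻ u = proj₂ (φ-surj u) refl
  φ⁻-inj : ∀ {u v} → φ⁻ u ≡ φ⁻ v → u ≡ v
  φ⁻-inj {u} {v} eq = trans (sym (φφ⁻ u)) (trans (cong φ eq) (φφ⁻ v))
  k<m : k < m
  k<m = +-cancelʳ-< 4 k m (≤-<-trans (Fin.injective⇒≤ φ⁻-inj) (<-≤-trans σ<π (Fin.injective⇒≤ ψ-inj)))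
  h : Fin (k + 4) → Fin (m + 4)
  h u = ψ (fn e (φ⁻ u))
  H : ℕ → ℕ
  H u with u <? k + 4
  ... | yes u< = toℕ (h (fromℕ< u<))
  -- A default value; `H` is only evaluated at vertices of the smaller fork.
  ... | no  _  = 0
  H≡ : ∀ {u} → u < 4 + k → ∃ λ (x : Fin (k + 4)) → toℕ x ≡ u × H u ≡ toℕ (h x)
  H≡ {u} u<′ with u <? k + 4
  ... | yes u< = fromℕ< u< , Fin.toℕ-fromℕ< u< , refl
  ... | no  u≮ = contradiction (subst (u <_) (+-comm 4 k) u<′) u≮
  H-inj : ∀ {u v} → u < 4 + k → v < 4 + k → H u ≡ H v → u ≡ v
  H-inj u< v< eq with H≡ u< | H≡ v<
  ... | x , refl , ex | y , refl , ey = cong toℕ (φ⁻-inj (injective e (ψ-inj (Fin.toℕ-injective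
          (trans (sym ex) (trans eq ey))))))
  H-edge : ∀ {u v} → u < 4 + k → v < 4 + k → ForkEdge k u v → Edge m (H u) (H v)
  H-edge u< v< edge with H≡ u< | H≡ v<
  ... | x , refl , ex | y , refl , ey = subst₂ (Edge m) (sym ex) (sym ey)
    (Equivalence.to (ψ-iso _ _) (inv e _ _ (Equivalence.from (φ-iso (φ⁻ x) (φ⁻ y))
      (inj₁ (subst₂ (λ a b → ForkEdge k (toℕ a) (toℕ b)) (sym (φφ⁻ x)) (sym (φφ⁻ y)) edge)))))

theorem9p3 : ExcludedMiddle 0ℓ → (C : List ℕ → Set) → IsPermClass C → SubsetAv321 C →
    WQO C ⇔ Finite (C ∩ InU)
theorem9p3 em C (perms , closed) av = mk⇔ finite wqo
  where
  open Classical em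

  finite : WQO C → Finite (C ∩ InU)
  finite no-antichain = ¬¬-elim λ infinite →
    let long : ∀ n → ∃ λ l → n ≤ l × ∃ λ π → (C ∩ InU) π × length π ≡ l
        -- If every member were shorter than `n`, all of them would occur in the finite list
        -- `words n n`.
        long n = ¬¬-elim λ none → infinite (words n n , λ π p →
          let π< = ≰⇒> λ n≤ → none (length π , n≤ , π , p , refl)
          in ∈-words (All.map (λ x< → <-trans x< π<) (proj₁ (proj₁ (proj₂ p)))) (<⇒≤ π<))
        h , inc , fork = unbounded⇒seq long
        a : ℕ → List ℕ
        a n = proj₁ (fork n)
        a-in : ∀ n → (C ∩ InU) (a n)
        a-in n = proj₁ (proj₂ (fork n))
        longer : ∀ i j → i < j → length (a i) < length (a j)
        longer i j i<j = subst₂ _<_ (sym (proj₂ (proj₂ (fork i)))) (sym (proj₂ (proj₂ (fork j)))) (inc i<j)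
        incomparable : ∀ i j → i ≢ j → ¬ (a i ≼ a j)
        incomparable i j i≢j e =
          let e′ = ≼⇒⊴ {a i} {a j} e
          in Sum.[ (λ i<j → InU-incomparable (proj₂ (a-in i)) (proj₂ (a-in j)) (longer i j i<j) e′)
                 , (λ j<i → <⇒≱ (longer j i j<i) (⊴-length e′)) ] (≢⇒<⊎> i≢j)
    in no-antichain (a , proj₁ ∘ a-in , incomparable)
    where
    ≢⇒<⊎> : ∀ {i j} → i ≢ j → i < j ⊎ j < i
    ≢⇒<⊎> {i} {j} i≢j with <-cmp i j
    ... | tri< lt _ _ = inj₁ lt
    ... | tri≈ _ e _  = contradiction e i≢j
    ... | tri> _ _ gt = inj₂ gt

  wqo : Finite (C ∩ InU) → WQO C
  wqo (L , complete) (a , a∈C , anti) =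
    let i , j , i<j , e = Good-wqo (λ n → a n , good (a∈C n))
    in anti i j (<⇒≢ i<j) (⊴⇒≼ e)
    where
    b = proj₁ (bounded-on length L)
    -- A fork on a path of k vertices has k + 4 vertices in all, more than the longest member of `L`
    -- once k ≥ b; the 2 provides 2 ≤ k, which `InU` demands.
    open Blocks em (2 + b)
    good : ∀ {π} → C π → Good π
    good {π} cπ = record
      { distinct = distinct
      ; avoids   = λ i<j j<k (kj , ji) → av π cπ (⊴⇒≼ (321-⊴ {π} i<j j<k kj ji))
      ; no-fork  = no-fork }
      where
      distinct : Distinct π
      distinct = lookup-injective (proj₂ (perms π cπ))
      no-fork : ∀ k → 2 + b ≤ k → ¬ ForkIn (InvGraph π) k
      no-fork k le fk with fork-perm {π} distinct (≤-trans (m≤m+n 2 b) le) fk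
      ... | σ , u , σ≼π , len = <⇒≱ (≤-trans (s≤s (n≤1+n b)) (≤-trans le (m≤m+n k 4)))
              (subst (_≤ b) len (proj₂ (bounded-on length L) (complete σ (closed σ π (proj₁ u) σ≼π cπ , u))))
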